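{- Let $n$ be a positive integer. If $G$ is a finite simple graph of order $n$ (i.e., with $n$ vertices) with $\kappa_3(G)=2$, then its number of edges satisfies $e(G)\geq \lceil \tfrac{6}{5}n\rceil$. Moreover, this lower bound is sharp for all $n\geq 4$ with $n\neq 9,10$: for every such $n$ there exists a finite simple graph $G$ of order $n$ with $\kappa_3(G)=2$ and $e(G)=\lceil \tfrac{6}{5}n\rceil$.
   Context: All graphs are finite and simple. For a nontrivial connected graph $G$ and a set $S$ of $3$ vertices of $G$, $\kappa(S)$ denotes the maximum number $\ell$ of edge-disjoint trees $T_1,\dots,T_\ell$ in $G$, each containing all vertices of $S$, such that $V(T_i)\cap V(T_j)=S$ for every pair of distinct $i,j$ (so the trees are internally disjoint). The generalized $3$-connectivity is $\kappa_3(G)=\min\{\kappa(S)\}$, the minimum taken over all $3$-subsets $S$ of $V(G)$. $e(G)$ denotes the number of edges of $G$. -}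

module Defs where

open import Data.Nat using (ℕ; zero; suc; _+_; _*_; _≤_; _<ᵇ_)
open import Data.Nat.DivMod using (_/_)
open import Data.Fin using (Fin; toℕ)
open import Data.Bool using (Bool; true; false; _∧_; if_then_else_)
open import Data.List using (List; []; _∷_; _++_; [_]; length; map; allFin)
open import Data.Nat.ListAction using (sum)
open import Data.List.Relation.Unary.Unique.Propositional using (Unique)
open import Data.Product using (Σ; _×_; ∃)
open import Data.Sum using (_⊎_)
open import Data.Unit using (⊤)
open import Data.Empty using (⊥)
open import Relation.Nullary using (¬_)
open import Relation.Binary.PropositionalEquality using (_≡_; _≢_)

record Graph (n : ℕ) : Set where
  field
    adj     : Fin n → Fin n → Bool
    adj-sym : ∀ u v → adj u v ≡ adj v u
    adj-irr : ∀ v → adj v v ≡ false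
open Graph public

e : ∀ {n} → Graph n → ℕ
e {n} G = sum (map (λ i → sum (map (λ j →
            if (toℕ i <ᵇ toℕ j) ∧ adj G i j then 1 else 0) (allFin n))) (allFin n))

data Walk {n : ℕ} (E : Fin n → Fin n → Bool) : Fin n → Fin n → Set where
  here : ∀ {u} → Walk E u u
  step : ∀ {u w v} → E u w ≡ true → Walk E w v → Walk E u v

Connected : ∀ {n} → Graph n → Set
Connected {n} G = ∀ (u v : Fin n) → Walk (adj G) u v

Chain : ∀ {n} → (Fin n → Fin n → Bool) → List (Fin n) → Set
Chain E []           = ⊤
Chain E (x ∷ [])     = ⊤
Chain E (x ∷ y ∷ ys) = (E x y ≡ true) × Chain E (y ∷ ys)

HasCycle : ∀ {n} → (Fin n → Fin n → Bool) → Set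
HasCycle {n} E = Σ (Fin n) λ x → Σ (List (Fin n)) λ ys →
  (2 ≤ length ys) × Unique (x ∷ ys) × Chain E (x ∷ ys ++ [ x ])

record Tree {n : ℕ} (G : Graph n) : Set where
  field
    V       : Fin n → Bool
    E       : Fin n → Fin n → Bool
    E-sym   : ∀ u v → E u v ≡ E v u
    E-sub   : ∀ u v → E u v ≡ true → adj G u v ≡ true
    E-endsV : ∀ u v → E u v ≡ true → V u ≡ true
    conn    : ∀ u v → V u ≡ true → V v ≡ true → Walk E u v
    acyclic : ¬ HasCycle E
open Tree public

_∈S[_,_,_] : ∀ {n} → Fin n → Fin n → Fin n → Fin n → Set
x ∈S[ a , b , c ] = (x ≡ a) ⊎ (x ≡ b) ⊎ (x ≡ c)

-- There exist ℓ internally disjoint S-trees (S = {a,b,c}): each contains S, they are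
-- pairwise edge-disjoint, and pairwise vertex intersections are exactly S
-- (⊇ S is automatic since each tree contains S).
HasSTrees : ∀ {n} → Graph n → Fin n → Fin n → Fin n → ℕ → Set
HasSTrees G a b c ℓ = Σ (Fin ℓ → Tree G) λ T →
    (∀ i → (V (T i) a ≡ true) × (V (T i) b ≡ true) × (V (T i) c ≡ true))
  × (∀ i j → i ≢ j → ∀ u v → E (T i) u v ≡ true → E (T j) u v ≡ false)
  × (∀ i j → i ≢ j → ∀ x → V (T i) x ≡ true → V (T j) x ≡ true → x ∈S[ a , b , c ])

Distinct3 : ∀ {n} → Fin n → Fin n → Fin n → Set
Distinct3 a b c = (a ≢ b) × (a ≢ c) × (b ≢ c)

-- κ₃(G) = 2 (for a nontrivial connected G): every 3-set S has κ(S) ≥ 2, and some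
-- 3-set S has κ(S) < 3, i.e. min over S of max ℓ equals 2.
κ₃≡2 : ∀ {n} → Graph n → Set
κ₃≡2 {n} G = (2 ≤ n) × Connected G
  × (∀ a b c → Distinct3 a b c → HasSTrees G a b c 2)
  × (Σ (Fin n) λ a → Σ (Fin n) λ b → Σ (Fin n) λ c →
       Distinct3 a b c × ¬ HasSTrees G a b c 3)

⌈_/5⌉ : ℕ → ℕ
⌈ m /5⌉ = (m + 4) / 5

{-# OPTIONS --safe #-}
module Submission where

-- Lower bound: two trees force minimum degree 2, and two adjacent vertices of degree 2 can
-- never be spanned twice together with a third vertex. So the set X of vertices of degree 2
-- is independent, and 2|X| ≤ e together with 3n - |X| ≤ 2e gives 6n ≤ 5e.
--
-- Sharpness: subdivide every edge of the Möbius ladder with m ≥ 3 rungs, which gives 5m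
-- vertices and 6m edges, and suppress j ≤ 4 of the subdividing vertices. A pair of trees for
-- S is encoded as a 2-colouring of edge ends that is constant at each vertex outside S. When
-- m ≥ 4 some column misses S; after a rotation it is column 0, and deleting it leaves a
-- shorter ladder whose colouring extends along the two rails. The case m = 3 is checked by
-- computation. Three trees never exist for an S containing a vertex of degree 2.

open import Defs
open import Data.Bool as Bool using (Bool; true; false; T; _∧_; _∨_; not; if_then_else_)
open import Data.Bool.ListAction using (all; any)
open import Data.Bool.Properties using (T-≡; T-∧; T-∨; ¬-not; ∨-zeroʳ; ∨-comm; ∧-comm)
open import Data.Empty using (⊥; ⊥-elim)
open import Data.Fin using (Fin; zero; suc; toℕ)
open import Data.Fin.Properties using (_≟_; toℕ-injective; toℕ<n; pigeonhole; any?; all?; ¬∀⟶∃¬)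
open import Data.List using (List; []; _∷_; _++_; [_]; _∷ʳ_; length; map; lookup; filterᵇ; concatMap; cartesianProduct; take; drop; upTo; allFin; initLast; _∷ʳ′_)
open import Data.List.Properties using (++-assoc; length-++; length-map; length-upTo; length-take; length-tabulate; take++drop≡id)
open import Data.List.Membership.Propositional using (_∈_; _∉_)
open import Data.List.Membership.Propositional.Properties
import Data.List.Membership.DecPropositional as DecMembership
open import Data.List.Relation.Unary.All as All using (All; []; _∷_)
import Data.List.Relation.Unary.All.Properties as Allₚ
open import Data.List.Relation.Unary.AllPairs using ([]; _∷_)
open import Data.List.Relation.Unary.Any as Any using (here; there)
import Data.List.Relation.Unary.Any.Properties as Anyₚ
open import Data.List.Relation.Unary.Unique.Propositional using (Unique)
import Data.List.Relation.Unary.Unique.Propositional.Properties as Uniqueₚ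
open import Data.Nat as ℕ using (ℕ; zero; suc; _+_; _*_; _≤_; _<_; z≤n; s≤s; _<ᵇ_; _≤ᵇ_; _≡ᵇ_; _<?_)
open import Data.Nat.DivMod using (_/_; _divMod_; result; /-monoˡ-≤; m<n*o⇒m/o<n; m/n*n≤m; m*n/n≡m)
open import Data.Nat.ListAction using (sum)
open import Data.Nat.Properties hiding (_≟_)
open import Data.Nat.Solver using (module +-*-Solver)
open import Data.Product using (Σ; ∃; _×_; _,_; proj₁; proj₂)
open import Data.Product.Properties using (≡-dec)
open import Data.Sum using (_⊎_; inj₁; inj₂; swap; [_,_]′)
open import Data.Unit using (tt)
open import Function using (_∘_; id; Equivalence)
open import Relation.Nullary using (¬_; Dec; yes; no; does; contradiction)
open import Relation.Nullary.Decidable using (dec-true; dec-false; decidable-stable; map′; _×-dec_; _⊎-dec_; ¬?; True; toWitness)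
open import Relation.Binary.Definitions using (DecidableEquality)
open import Relation.Binary.Construct.Closure.ReflexiveTransitive using (Star; ε; _◅_; _◅◅_; reverse; kleisliStar)
open import Relation.Binary.PropositionalEquality hiding ([_])
open +-*-Solver using (solve; _:+_; _:*_; _:=_; con)

-- Equality `6n = 5e` forces equality in both estimates: all degrees are 2 or 3, and every edge has
-- exactly one end of degree 2. So an extremal graph has to come from a cubic one by subdividing
-- every edge. A cubic graph on `2m` vertices then yields order `5m` and size `6m`; suppressing a
-- subdividing vertex removes one vertex and one edge, and `6m - j` equals the rounded-up
-- `6(5m - j)/5` exactly for `j ≤ 4`. With `m ≥ 3` this reaches every order from 11 on; orders 4 to
-- 8 get graphs of their own.
--
-- Surgery on the trees themselves would have to preserve acyclicity and disjointness at every step.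
-- Colouring ends of edges leaves only a local condition, constancy outside S, and reachability
-- within each colour; genuine trees are extracted once, at the end. Ends are coloured instead of
-- edges so that vertices of S can serve both trees, while an edge whose ends disagree belongs to
-- neither.
--
-- The Möbius ladder suits the induction because its rotation permutes the columns cyclically, so
-- that any column missing S can be treated as the one next to the crossing.

private variable
  A B : Set
  n ℓ : ℕ

-- Degrees and the lower bound

∑ : List A → (A → ℕ) → ℕ
∑ xs f = sum (map f xs)

⟦_⟧ : Bool → ℕ
⟦ b ⟧ = if b then 1 else 0

∑-mono : ∀ (xs : List A) {f g : A → ℕ} → (∀ x → f x ≤ g x) → ∑ xs f ≤ ∑ xs g
∑-mono []       f≤g = z≤n
∑-mono (x ∷ xs) f≤g = +-mono-≤ (f≤g x) (∑-mono xs f≤g)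

∑-cong : ∀ (xs : List A) {f g : A → ℕ} → (∀ x → f x ≡ g x) → ∑ xs f ≡ ∑ xs g
∑-cong []       f≡g = refl
∑-cong (x ∷ xs) f≡g = cong₂ _+_ (f≡g x) (∑-cong xs f≡g)

+-exchange : ∀ a b c d → (a + b) + (c + d) ≡ (a + c) + (b + d)
+-exchange = solve 4 (λ a b c d → (a :+ b) :+ (c :+ d) := (a :+ c) :+ (b :+ d)) refl

∑-+ : ∀ (xs : List A) (f g : A → ℕ) → ∑ xs (λ x → f x + g x) ≡ ∑ xs f + ∑ xs g
∑-+ []       f g = refl
∑-+ (x ∷ xs) f g = trans (cong (f x + g x +_) (∑-+ xs f g)) (+-exchange (f x) (g x) _ _)

∑-* : ∀ (xs : List A) c (f : A → ℕ) → ∑ xs (λ x → c * f x) ≡ c * ∑ xs f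
∑-* []       c f = sym (*-zeroʳ c)
∑-* (x ∷ xs) c f = trans (cong (c * f x +_) (∑-* xs c f)) (sym (*-distribˡ-+ c (f x) _))

∑-const : ∀ (xs : List A) c → ∑ xs (λ _ → c) ≡ length xs * c
∑-const []       c = refl
∑-const (x ∷ xs) c = cong (c +_) (∑-const xs c)

∑-zero : ∀ (xs : List A) → ∑ xs (λ _ → 0) ≡ 0
∑-zero xs = trans (∑-const xs 0) (*-zeroʳ (length xs))

∑-swap : ∀ (xs : List A) (ys : List B) (f : A → B → ℕ) →
  ∑ xs (λ x → ∑ ys (f x)) ≡ ∑ ys (λ y → ∑ xs (λ x → f x y))
∑-swap []       ys f = sym (∑-zero ys)
∑-swap (x ∷ xs) ys f = trans (cong (∑ ys (f x) +_) (∑-swap xs ys f)) (sym (∑-+ ys (f x) _))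

∑-∈ : ∀ {xs : List A} {x} (f : A → ℕ) → x ∈ xs → f x ≤ ∑ xs f
∑-∈ f (here refl) = m≤m+n _ _
∑-∈ f (there x∈xs) = ≤-trans (∑-∈ f x∈xs) (m≤n+m _ _)

∑-positive : ∀ (xs : List A) (f : A → ℕ) → 1 ≤ ∑ xs f → ∃ λ x → 1 ≤ f x
∑-positive (x ∷ xs) f pos with f x in eq
... | zero  = ∑-positive xs f pos
... | suc _ = x , subst (1 ≤_) (sym eq) (s≤s z≤n)

∑-unique : ∀ {xs : List A} (f : A → ℕ) → Unique xs → (∀ x → f x ≤ 1) →
  (∀ x y → 1 ≤ f x → 1 ≤ f y → x ≡ y) → ∑ xs f ≤ 1
∑-unique f [] f≤1 unique = z≤n
∑-unique {xs = x ∷ xs} f (x∉xs ∷ uniq) f≤1 unique with f x in eq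
... | zero  = ∑-unique f uniq f≤1 unique
... | suc k = subst (_≤ 1) (sym (trans (cong (suc k +_) (vanish x∉xs)) (+-identityʳ _))) (subst (_≤ 1) eq (f≤1 x))
  where
  vanish : ∀ {ys} → All (x ≢_) ys → ∑ ys f ≡ 0
  vanish [] = refl
  vanish {y ∷ _} (x≢y ∷ rest) with f y in eq′
  ... | zero  = vanish rest
  ... | suc _ = contradiction (unique x y (subst (1 ≤_) (sym eq) (s≤s z≤n)) (subst (1 ≤_) (sym eq′) (s≤s z≤n))) x≢y

⟦⟧≤1 : ∀ b → ⟦ b ⟧ ≤ 1
⟦⟧≤1 true  = ≤-refl
⟦⟧≤1 false = z≤n

1≤⟦⟧ : ∀ {b} → 1 ≤ ⟦ b ⟧ → b ≡ true
1≤⟦⟧ {true} _ = refl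

dec-true⁻ : ∀ {P : Set} (d : Dec P) → does d ≡ true → P
dec-true⁻ (yes p) _ = p

length-allFin : ∀ n → length (allFin n) ≡ n
length-allFin n = length-tabulate id

∑² : (Fin n → Fin n → ℕ) → ℕ
∑² {n} f = ∑ (allFin n) λ i → ∑ (allFin n) (f i)

∑²-mono : {f g : Fin n → Fin n → ℕ} → (∀ i j → f i j ≤ g i j) → ∑² f ≤ ∑² g
∑²-mono {n} f≤g = ∑-mono (allFin n) λ i → ∑-mono (allFin n) (f≤g i)

∑²-cong : {f g : Fin n → Fin n → ℕ} → (∀ i j → f i j ≡ g i j) → ∑² f ≡ ∑² g
∑²-cong {n} f≡g = ∑-cong (allFin n) λ i → ∑-cong (allFin n) (f≡g i)

∑²-+ : (f g : Fin n → Fin n → ℕ) → ∑² (λ i j → f i j + g i j) ≡ ∑² f + ∑² g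
∑²-+ {n} f g = trans (∑-cong (allFin n) λ i → ∑-+ (allFin n) (f i) (g i)) (∑-+ (allFin n) _ _)

_≺_ : Fin n → Fin n → Bool
i ≺ j = toℕ i <ᵇ toℕ j

-- The diagonal vanishes and the part below it is transposed onto the part above. This turns sums
-- over incidences into sums over edges, both for the handshake identity and for charging vertices
-- of degree 2 to edges.
∑²-unordered : (f : Fin n → Fin n → ℕ) → (∀ i → f i i ≡ 0) →
  ∑² f ≡ ∑² (λ i j → if i ≺ j then f i j + f j i else 0)
∑²-unordered {n} f diag = begin
  ∑² f                                      ≡⟨ ∑²-cong split ⟩
  ∑² (λ i j → up i j + down i j)            ≡⟨ ∑²-+ up down ⟩
  ∑² up + ∑² down                           ≡⟨ cong (∑² up +_) (∑-swap (allFin n) (allFin n) down) ⟩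
  ∑² up + ∑² (λ i j → down j i)             ≡⟨ ∑²-+ up (λ i j → down j i) ⟨
  ∑² (λ i j → up i j + down j i)            ≡⟨ ∑²-cong merge ⟩
  ∑² (λ i j → if i ≺ j then f i j + f j i else 0) ∎
  where
  open ≡-Reasoning
  up down : Fin n → Fin n → ℕ
  up   i j = if i ≺ j then f i j else 0
  down i j = if j ≺ i then f i j else 0
  split : ∀ i j → f i j ≡ up i j + down i j
  split i j with i ≺ j in p | j ≺ i in q
  ... | true  | true  = ⊥-elim (<-asym (lt (toℕ i) (toℕ j) p) (lt (toℕ j) (toℕ i) q))
    where lt : ∀ a b → (a <ᵇ b) ≡ true → a < b
          lt a b eq = <ᵇ⇒< a b (Equivalence.from T-≡ eq)
  ... | true  | false = sym (+-identityʳ _)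
  ... | false | true  = refl
  ... | false | false = trans (cong (f i) (sym i≡j)) (diag i)
    where
    ge : ∀ a b → (a <ᵇ b) ≡ false → b ≤ a
    ge a b eq = ≮⇒≥ λ a<b → contradiction (trans (sym (Equivalence.to T-≡ (<⇒<ᵇ a<b))) eq) λ ()
    i≡j : i ≡ j
    i≡j = toℕ-injective (≤-antisym (ge (toℕ j) (toℕ i) q) (ge (toℕ i) (toℕ j) p))
  merge : ∀ i j → up i j + down j i ≡ (if i ≺ j then f i j + f j i else 0)
  merge i j with i ≺ j
  ... | true  = refl
  ... | false = refl

deg : Graph n → Fin n → ℕ
deg {n} G v = ∑ (allFin n) λ u → ⟦ adj G v u ⟧

-- Double counting of the pairs `p = u` with `p` in the list: each `p` meets some `u`, and each `u`
-- is met at most once, and only if it is adjacent to `v`.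
neighbours≤deg : ∀ (G : Graph n) v {ps} → Unique ps → All (λ p → adj G v p ≡ true) ps →
  length ps ≤ deg G v
neighbours≤deg {n} G v {ps} uniq nbrs = begin
  length ps                                                   ≡⟨ *-identityʳ _ ⟨
  length ps * 1                                               ≡⟨ ∑-const ps 1 ⟨
  ∑ ps (λ _ → 1)                                              ≤⟨ ∑-mono ps hit ⟩
  ∑ ps (λ p → ∑ (allFin n) λ u → ⟦ does (p ≟ u) ⟧)            ≡⟨ ∑-swap ps (allFin n) _ ⟩
  ∑ (allFin n) (λ u → ∑ ps λ p → ⟦ does (p ≟ u) ⟧)            ≤⟨ ∑-mono (allFin n) bound ⟩
  deg G v                                                     ∎
  where
  open ≤-Reasoning
  hit : ∀ p → 1 ≤ ∑ (allFin n) λ u → ⟦ does (p ≟ u) ⟧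
  hit p = ≤-trans (≤-reflexive (sym (cong ⟦_⟧ (dec-true (p ≟ p) refl)))) (∑-∈ _ (∈-allFin p))
  nonadjacent : ∀ {u qs} → adj G v u ≡ false → All (λ p → adj G v p ≡ true) qs →
    ∑ qs (λ p → ⟦ does (p ≟ u) ⟧) ≡ 0
  nonadjacent non [] = refl
  nonadjacent {u} {q ∷ _} non (vq ∷ vqs) with q ≟ u
  ... | yes refl = contradiction (trans (sym vq) non) λ ()
  ... | no  _    = nonadjacent non vqs
  bound : ∀ u → ∑ ps (λ p → ⟦ does (p ≟ u) ⟧) ≤ ⟦ adj G v u ⟧
  bound u with adj G v u in eq
  ... | true  = ∑-unique _ uniq (λ _ → ⟦⟧≤1 _)
    λ p q p=u q=u → trans (is-u p p=u) (sym (is-u q q=u))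
    where
    is-u : ∀ p → 1 ≤ ⟦ does (p ≟ u) ⟧ → p ≡ u
    is-u p = dec-true⁻ (p ≟ u) ∘ 1≤⟦⟧
  ... | false = ≤-reflexive (nonadjacent eq nbrs)

handshake : (G : Graph n) → ∑ (allFin n) (deg G) ≡ 2 * e G
handshake {n} G = begin
  ∑² (λ i j → ⟦ adj G i j ⟧)                                                ≡⟨ ∑²-unordered _ (λ i → cong ⟦_⟧ (adj-irr G i)) ⟩
  ∑² (λ i j → if i ≺ j then ⟦ adj G i j ⟧ + ⟦ adj G j i ⟧ else 0)           ≡⟨ ∑²-cong double ⟩
  ∑² (λ i j → 2 * ⟦ i ≺ j ∧ adj G i j ⟧)                                    ≡⟨ ∑-cong (allFin n) (λ i → ∑-* (allFin n) 2 _) ⟩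
  ∑ (allFin n) (λ i → 2 * ∑ (allFin n) λ j → ⟦ i ≺ j ∧ adj G i j ⟧)         ≡⟨ ∑-* (allFin n) 2 _ ⟩
  2 * e G                                                                   ∎
  where
  open ≡-Reasoning
  double : ∀ i j → (if i ≺ j then ⟦ adj G i j ⟧ + ⟦ adj G j i ⟧ else 0) ≡ 2 * ⟦ i ≺ j ∧ adj G i j ⟧
  double i j rewrite adj-sym G j i with i ≺ j | adj G i j
  ... | true  | true  = refl
  ... | true  | false = refl
  ... | false | _     = refl

-- Disjoint trees at vertices of small degree

walk-closed : ∀ {E : Fin n → Fin n → Bool} {P : Fin n → Set} →
  (∀ {s t} → P s → E s t ≡ true → P t) → ∀ {s t} → Walk E s t → P s → P t
walk-closed closed here          Ps = Ps
walk-closed closed (step st rest) Ps = walk-closed closed rest (closed Ps st)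

first-step : ∀ {E : Fin n → Fin n → Bool} {s t} → s ≢ t → Walk E s t → ∃ λ u → E s u ≡ true
first-step s≢t here       = contradiction refl s≢t
first-step s≢t (step {w = u} su _) = u , su

module _ (G : Graph n) {a b c : Fin n} (dist : Distinct3 a b c) where

  tree-neighbour : ((T , _) : HasSTrees G a b c ℓ) → ∀ i → ∃ λ u → E (T i) a u ≡ true
  tree-neighbour (T , S⊆V , _) i =
    first-step (proj₁ dist) (conn (T i) a b (proj₁ (S⊆V i)) (proj₁ (proj₂ (S⊆V i))))

  -- Each tree leaves `a` along some edge towards `b`, and edge-disjointness makes the chosen
  -- neighbours distinct. It serves both directions: two trees force degree at least 2, and a vertex
  -- of degree at most 2 rules out three trees.
  trees≤deg : HasSTrees G a b c ℓ → ℓ ≤ deg G a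
  trees≤deg {ℓ} trees@(T , _ , edge-disj , _) =
    subst (_≤ deg G a) (length-tabulate nbr)
      (neighbours≤deg G a (Uniqueₚ.tabulate⁺ nbr-injective)
        (Allₚ.tabulate⁺ λ i → E-sub (T i) a (nbr i) (nbr-edge i)))
    where
    nbr : Fin ℓ → Fin n
    nbr i = proj₁ (tree-neighbour trees i)
    nbr-edge : ∀ i → E (T i) a (nbr i) ≡ true
    nbr-edge i = proj₂ (tree-neighbour trees i)
    nbr-injective : ∀ {i j} → nbr i ≡ nbr j → i ≡ j
    nbr-injective {i} {j} eq with i ≟ j
    ... | yes i≡j = i≡j
    ... | no  i≢j = contradiction
      (trans (sym (edge-disj i j i≢j a (nbr i) (nbr-edge i)))
             (trans (cong (E (T j) a) eq) (nbr-edge j)))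
      λ ()

-- If uv lies in one of the two trees, that tree has no other edge at u or at v
-- and so never reaches w; if it lies in neither, u has two more neighbours.
module _ (G : Graph n) {u v w : Fin n} (dist : Distinct3 u v w)
         (uv : adj G u v ≡ true) (deg-u : deg G u ≤ 2) (deg-v : deg G v ≤ 2) where

  private
    three : ∀ x {p q r} → deg G x ≤ 2 → p ≢ q → p ≢ r → q ≢ r →
      adj G x p ≡ true → adj G x q ≡ true → adj G x r ≡ true → ⊥
    three x {p} {q} {r} d≤2 p≢q p≢r q≢r xp xq xr = <⇒≱ (s≤s d≤2)
      (neighbours≤deg G x {p ∷ q ∷ r ∷ []}
        ((p≢q ∷ p≢r ∷ []) ∷ (q≢r ∷ []) ∷ [] ∷ []) (xp ∷ xq ∷ xr ∷ []))

    only : ∀ (T T′ : Tree G) {x y} → adj G x y ≡ true → deg G x ≤ 2 → (∃ λ q → E T′ x q ≡ true) →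
      (∀ s t → E T s t ≡ true → E T′ s t ≡ false) → E T x y ≡ true → ∀ {s} → E T x s ≡ true → s ≡ y
    only T T′ {x} {y} xy d≤2 (q , xq) disj Txy {s} Txs with s ≟ y
    ... | yes s≡y = s≡y
    ... | no  s≢y = ⊥-elim (three x d≤2 s≢y (distinct Txs) (distinct Txy)
                       (E-sub T x s Txs) xy (E-sub T′ x q xq))
      where
      distinct : ∀ {z} → E T x z ≡ true → z ≢ q
      distinct {z} Txz refl = contradiction (trans (sym (disj x z Txz)) xq) λ ()

    no-walk : ∀ (T T′ : Tree G) →
      (∃ λ q → E T′ u q ≡ true) → (∃ λ q → E T′ v q ≡ true) →
      (∀ s t → E T s t ≡ true → E T′ s t ≡ false) → E T u v ≡ true → ¬ Walk (E T) u w
    no-walk T T′ u-nbr v-nbr disj Tuv walk with walk-closed closed walk (inj₁ refl)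
      where
      closed : ∀ {s t} → s ≡ u ⊎ s ≡ v → E T s t ≡ true → t ≡ u ⊎ t ≡ v
      closed (inj₁ refl) st = inj₂ (only T T′ uv deg-u u-nbr disj Tuv st)
      closed (inj₂ refl) st = inj₁ (only T T′ (trans (adj-sym G v u) uv) deg-v v-nbr disj
                                     (trans (E-sym T v u) Tuv) st)
    ... | inj₁ w≡u = proj₁ (proj₂ dist) (sym w≡u)
    ... | inj₂ w≡v = proj₂ (proj₂ dist) (sym w≡v)

  adjacent-degree-two : ¬ HasSTrees G u v w 2
  adjacent-degree-two trees@(T , S⊆V , edge-disj , _) =
    three u deg-u (λ v≡p → false≢true (unused zero (suc zero) (λ ())) (trans (cong (E (T zero) u) v≡p) (proj₂ u₀)))
                  (λ v≡q → false≢true (unused (suc zero) zero (λ ())) (trans (cong (E (T (suc zero)) u) v≡q) (proj₂ u₁)))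
      p≢q uv
      (E-sub (T zero) u _ (proj₂ u₀)) (E-sub (T (suc zero)) u _ (proj₂ u₁))
    where
    false≢true : ∀ {x : Bool} → x ≡ false → x ≡ true → ⊥
    false≢true refl ()
    nbr-u : ∀ i → ∃ λ q → E (T i) u q ≡ true
    nbr-u i = first-step (proj₁ dist) (conn (T i) u v (proj₁ (S⊆V i)) (proj₁ (proj₂ (S⊆V i))))
    nbr-v : ∀ i → ∃ λ q → E (T i) v q ≡ true
    nbr-v i = first-step (proj₁ dist ∘ sym) (conn (T i) v u (proj₁ (proj₂ (S⊆V i))) (proj₁ (S⊆V i)))
    unused : ∀ i j → i ≢ j → E (T i) u v ≡ false
    unused i j i≢j with E (T i) u v in eq
    ... | false = refl
    ... | true  = ⊥-elim (no-walk (T i) (T j) (nbr-u j) (nbr-v j) (edge-disj i j i≢j) eq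
                    (conn (T i) u w (proj₁ (S⊆V i)) (proj₂ (proj₂ (S⊆V i)))))
    u₀ = nbr-u zero
    u₁ = nbr-u (suc zero)
    p≢q : proj₁ u₀ ≢ proj₁ u₁
    p≢q p≡q = false≢true (edge-disj zero (suc zero) (λ ()) u _ (proj₂ u₀))
                (trans (cong (E (T (suc zero)) u) p≡q) (proj₂ u₁))

-- Counting edges for the lower bound

sharp-arith : ∀ m n → 6 * n ≤ 5 * m → ⌈ 6 * n /5⌉ ≤ m
sharp-arith m n 6n≤5m = ≤-pred (m<n*o⇒m/o<n {o = 5} (begin-strict
  6 * n + 4      ≤⟨ +-monoˡ-≤ 4 6n≤5m ⟩
  5 * m + 4      <⟨ n<1+n _ ⟩
  suc (5 * m + 4) ≡⟨ solve 1 (λ m → con 1 :+ (con 5 :* m :+ con 4) := (con 1 :+ m) :* con 5) refl m ⟩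
  suc m * 5      ∎))
  where
  open ≤-Reasoning

module _ (G : Graph n) where

  pick-two : (Σ (Fin n) λ a → Σ (Fin n) λ b → Σ (Fin n) λ c → Distinct3 a b c) →
    ∀ v → Σ (Fin n) λ x → Σ (Fin n) λ y → Distinct3 v x y
  pick-two (a , b , c , a≢b , a≢c , b≢c) v with v ≟ a | v ≟ b
  ... | yes refl | _        = b , c , a≢b , a≢c , b≢c
  ... | no v≢a   | yes refl = a , c , a≢b ∘ sym , b≢c , a≢c
  ... | no v≢a   | no v≢b   = a , b , v≢a , v≢b , a≢b

  third : (Σ (Fin n) λ a → Σ (Fin n) λ b → Σ (Fin n) λ c → Distinct3 a b c) →
    ∀ u v → u ≢ v → Σ (Fin n) λ w → Distinct3 u v w
  third abc u v u≢v with pick-two abc u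
  ... | x , y , u≢x , u≢y , x≢y with x ≟ v
  ...   | no  x≢v  = x , u≢v , u≢x , x≢v ∘ sym
  ...   | yes refl = y , u≢v , u≢y , x≢y

  size-bound : κ₃≡2 G → ⌈ 6 * n /5⌉ ≤ e G
  size-bound (_ , _ , two-trees , a , b , c , dist , _) = sharp-arith (e G) n (begin
    6 * n                           ≡⟨ solve 1 (λ n → con 6 :* n := con 2 :* (n :* con 3)) refl n ⟩
    2 * (n * 3)                     ≤⟨ *-monoʳ-≤ 2 3n≤2e+X ⟩
    2 * (2 * e G + X)               ≡⟨ *-distribˡ-+ 2 (2 * e G) X ⟩
    2 * (2 * e G) + 2 * X           ≤⟨ +-monoʳ-≤ _ 2X≤e ⟩
    2 * (2 * e G) + e G             ≡⟨ solve 1 (λ m → con 2 :* (con 2 :* m) :+ m := con 5 :* m) refl (e G) ⟩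
    5 * e G                         ∎)
    where
    open ≤-Reasoning

    abc = a , b , c , dist

    small : Fin n → Bool
    small v = deg G v ≤ᵇ 2

    small⇒≤2 : ∀ {v} → small v ≡ true → deg G v ≤ 2
    small⇒≤2 {v} eq = ≤ᵇ⇒≤ (deg G v) 2 (Equivalence.from T-≡ eq)

    ¬small⇒≥3 : ∀ {v} → small v ≡ false → 3 ≤ deg G v
    ¬small⇒≥3 eq = ≰⇒> λ deg≤2 → contradiction (trans (sym (Equivalence.to T-≡ (≤⇒≤ᵇ deg≤2))) eq) λ ()

    X : ℕ
    X = ∑ (allFin n) λ v → ⟦ small v ⟧

    2≤deg : ∀ v → 2 ≤ deg G v
    2≤deg v with x , y , vxy ← pick-two abc v = trees≤deg G vxy (two-trees v x y vxy)

    3≤deg+X : ∀ v → 3 ≤ deg G v + ⟦ small v ⟧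
    3≤deg+X v with small v in eq
    ... | true  = +-monoˡ-≤ 1 (2≤deg v)
    ... | false = ≤-trans (¬small⇒≥3 eq) (m≤m+n _ 0)

    3n≤2e+X : n * 3 ≤ 2 * e G + X
    3n≤2e+X = begin
      n * 3                                        ≡⟨ cong (_* 3) (length-allFin n) ⟨
      length (allFin n) * 3                        ≡⟨ ∑-const (allFin n) 3 ⟨
      ∑ (allFin n) (λ _ → 3)                       ≤⟨ ∑-mono (allFin n) 3≤deg+X ⟩
      ∑ (allFin n) (λ v → deg G v + ⟦ small v ⟧)   ≡⟨ ∑-+ (allFin n) _ _ ⟩
      ∑ (allFin n) (deg G) + X                     ≡⟨ cong (_+ X) (handshake G) ⟩
      2 * e G + X                                  ∎

    -- Discharging: a vertex of degree at most 2 puts weight 1 on each incident edge, in total at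
    -- least 2 by `2≤deg`. An edge would receive weight from both ends only if two such vertices
    -- were adjacent, which `adjacent-degree-two` forbids, so the total weight is at most `e G`.
    share : Fin n → Fin n → ℕ
    share u v = ⟦ small u ⟧ * ⟦ adj G u v ⟧

    2x≤shares : ∀ u → 2 * ⟦ small u ⟧ ≤ ∑ (allFin n) (share u)
    2x≤shares u = begin
      2 * ⟦ small u ⟧               ≤⟨ *-monoˡ-≤ ⟦ small u ⟧ (2≤deg u) ⟩
      deg G u * ⟦ small u ⟧         ≡⟨ *-comm (deg G u) _ ⟩
      ⟦ small u ⟧ * deg G u         ≡⟨ ∑-* (allFin n) ⟦ small u ⟧ _ ⟨
      ∑ (allFin n) (share u)        ∎

    shared-edge : ∀ u v → (if u ≺ v then share u v + share v u else 0) ≤ ⟦ u ≺ v ∧ adj G u v ⟧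
    shared-edge u v rewrite adj-sym G v u with u ≺ v
    ... | false = z≤n
    ... | true with adj G u v in uv
    ...   | false rewrite *-zeroʳ ⟦ small u ⟧ | *-zeroʳ ⟦ small v ⟧ = z≤n
    ...   | true with small u in small-u | small v in small-v
    ...     | false | false = z≤n
    ...     | false | true  = ≤-refl
    ...     | true  | false = ≤-refl
    ...     | true  | true  = ⊥-elim (both (third abc u v u≢v))
      where
      u≢v : u ≢ v
      u≢v refl = contradiction (trans (sym uv) (adj-irr G u)) λ ()
      both : Σ (Fin n) (λ w → Distinct3 u v w) → ⊥
      both (w , uvw) = adjacent-degree-two G uvw uv (small⇒≤2 small-u) (small⇒≤2 small-v) (two-trees u v w uvw)

    2X≤e : 2 * X ≤ e G
    2X≤e = begin
      2 * X                                                          ≡⟨ ∑-* (allFin n) 2 _ ⟨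
      ∑ (allFin n) (λ u → 2 * ⟦ small u ⟧)                           ≤⟨ ∑-mono (allFin n) 2x≤shares ⟩
      ∑² share                                                       ≡⟨ ∑²-unordered share loop ⟩
      ∑² (λ u v → if u ≺ v then share u v + share v u else 0)        ≤⟨ ∑²-mono shared-edge ⟩
      e G                                                            ∎
      where
      loop : ∀ u → share u u ≡ 0
      loop u = trans (cong (λ b → ⟦ small u ⟧ * ⟦ b ⟧) (adj-irr G u)) (*-zeroʳ ⟦ small u ⟧)

-- Growing trees inside a colour class

-- If all degrees were at least 3, the handshake identity would give `15 n ≤ 10 e ≤ 12 n + 8`, hence
-- `3 n ≤ 8`, against `n ≥ 4`. This supplies the vertex at which three trees fail.
sparse⇒¬cubic : (G : Graph n) → 4 ≤ n → e G ≤ ⌈ 6 * n /5⌉ → ¬ (∀ v → 2 < deg G v)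
sparse⇒¬cubic {n} G 4≤n e≤ 2<deg = <⇒≱ (≤-trans (m≤m+n 9 3) (*-monoʳ-≤ 3 4≤n))
  (+-cancelˡ-≤ (12 * n) (3 * n) 8 (begin
    12 * n + 3 * n                  ≡⟨ solve 1 (λ n → con 12 :* n :+ con 3 :* n := con 5 :* (n :* con 3)) refl n ⟩
    5 * (n * 3)                     ≤⟨ *-monoʳ-≤ 5 3n≤2e ⟩
    5 * (2 * e G)                   ≤⟨ *-monoʳ-≤ 5 (*-monoʳ-≤ 2 e≤) ⟩
    5 * (2 * ((6 * n + 4) / 5))     ≡⟨ solve 1 (λ q → con 5 :* (con 2 :* q) := con 2 :* (q :* con 5)) refl ((6 * n + 4) / 5) ⟩
    2 * ((6 * n + 4) / 5 * 5)       ≤⟨ *-monoʳ-≤ 2 (m/n*n≤m (6 * n + 4) 5) ⟩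
    2 * (6 * n + 4)                 ≡⟨ solve 1 (λ n → con 2 :* (con 6 :* n :+ con 4) := con 12 :* n :+ con 8) refl n ⟩
    12 * n + 8                      ∎))
  where
  open ≤-Reasoning
  3n≤2e : n * 3 ≤ 2 * e G
  3n≤2e = begin
    n * 3                        ≡⟨ cong (_* 3) (length-allFin n) ⟨
    length (allFin n) * 3        ≡⟨ ∑-const (allFin n) 3 ⟨
    ∑ (allFin n) (λ _ → 3)       ≤⟨ ∑-mono (allFin n) 2<deg ⟩
    ∑ (allFin n) (deg G)         ≡⟨ handshake G ⟩
    2 * e G                      ∎

-- Connectedness is read off a tree through the two vertices and any third one; the triple without
-- three trees is completed from a vertex of degree at most 2, which sparsity provides.
κ₃≡2-from-size : (G : Graph n) → 4 ≤ n → (∀ a b c → Distinct3 a b c → HasSTrees G a b c 2) →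
  e G ≤ ⌈ 6 * n /5⌉ → κ₃≡2 G
κ₃≡2-from-size {n} G 4≤n@(s≤s (s≤s (s≤s _))) two-trees e≤ =
  s≤s (s≤s z≤n) , connected , two-trees , witness
  where
  distinct₀ : Σ (Fin n) λ a → Σ (Fin n) λ b → Σ (Fin n) λ c → Distinct3 a b c
  distinct₀ = zero , suc zero , suc (suc zero) , (λ ()) , (λ ()) , (λ ())

  connected : Connected G
  connected u v with u ≟ v
  ... | yes refl = here
  ... | no  u≢v with w , dist ← third G distinct₀ u v u≢v
                 with T , S⊆V , _ ← two-trees u v w dist =
    in-G (conn (T zero) u v (proj₁ (S⊆V zero)) (proj₁ (proj₂ (S⊆V zero))))
    where
    in-G : ∀ {s t} → Walk (E (T zero)) s t → Walk (adj G) s t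
    in-G here                = here
    in-G (step {s} {t} st w) = step (E-sub (T zero) s t st) (in-G w)

  witness : Σ (Fin n) λ a → Σ (Fin n) λ b → Σ (Fin n) λ c → Distinct3 a b c × ¬ HasSTrees G a b c 3
  witness =
    let v , deg≤2     = ¬∀⟶∃¬ n (λ v → 2 < deg G v) (λ v → 2 <? deg G v) (sparse⇒¬cubic G 4≤n e≤)
        x , y , vxy   = pick-two G distinct₀ v
    in v , x , y , vxy , λ trees → deg≤2 (trees≤deg G vxy trees)

-- Walks, cycles and trees grown leaf by leaf

∨-true : ∀ {x y} → x ∨ y ≡ true → x ≡ true ⊎ y ≡ true
∨-true {true}  _  = inj₁ refl
∨-true {false} eq = inj₂ eq

∧-true : ∀ {x y} → x ∧ y ≡ true → x ≡ true × y ≡ true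
∧-true {true} eq = refl , eq

walk-++ : ∀ {E : Fin n → Fin n → Bool} {s t u} → Walk E s t → Walk E t u → Walk E s u
walk-++ here        q = q
walk-++ (step st p) q = step st (walk-++ p q)

walk-map : ∀ {E F : Fin n → Fin n → Bool} → (∀ {s t} → E s t ≡ true → F s t ≡ true) →
  ∀ {s t} → Walk E s t → Walk F s t
walk-map E⊆F here        = here
walk-map E⊆F (step st p) = step (E⊆F st) (walk-map E⊆F p)

module _ {R : Fin n → Fin n → Bool} where

  chain-middle : ∀ xs {p w s zs} → Chain R (xs ++ p ∷ w ∷ s ∷ zs) → R p w ≡ true × R w s ≡ true
  chain-middle []           (pw , ws , _) = pw , ws
  chain-middle (x ∷ [])     (_ , chain)   = chain-middle [] chain
  chain-middle (x ∷ y ∷ xs) (_ , chain)   = chain-middle (y ∷ xs) chain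

  chain-end : ∀ xs {p q} → Chain R (xs ++ p ∷ q ∷ []) → R p q ≡ true
  chain-end []           (pq , _)    = pq
  chain-end (x ∷ [])     (_ , chain) = chain-end [] chain
  chain-end (x ∷ y ∷ xs) (_ , chain) = chain-end (y ∷ xs) chain

-- The two neighbours are those along the cycle. As the cycle is a list closed up by its head, the
-- head, the first and the last entry of the tail, and the interior entries are separate cases;
-- `2 ≤ length ys` excludes the one in which both neighbours would be the head.
cycle-neighbours : {R : Fin n → Fin n → Bool} → (∀ u v → R u v ≡ R v u) →
  ∀ {x ys w} → 2 ≤ length ys → Unique (x ∷ ys) → Chain R (x ∷ ys ++ [ x ]) → w ∈ x ∷ ys →
  ∃ λ p → ∃ λ s → p ≢ s × R w p ≡ true × R w s ≡ true
cycle-neighbours R-sym {x} {y ∷ ys} long uniq chain (here refl) with initLast ys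
... | []       = contradiction long λ { (s≤s ()) }
... | zs ∷ʳ′ z = y , z , y≢z uniq , proj₁ chain ,
    trans (R-sym x z) (chain-end (x ∷ y ∷ zs) (subst (Chain _) (cong (λ l → x ∷ y ∷ l) (++-assoc zs (z ∷ []) (x ∷ []))) chain))
  where
  y≢z : ∀ {x y z : Fin _} {zs} → Unique (x ∷ y ∷ zs ∷ʳ z) → y ≢ z
  y≢z {zs = zs} (_ ∷ y∉ ∷ _) = All.lookup y∉ (∈-++⁺ʳ zs (here refl))
cycle-neighbours R-sym {x} {ys} {w} long uniq@(x∉ys ∷ uniq-ys) chain (there w∈ys)
  with as , bs , refl ← ∈-∃++ w∈ys = inner as bs long x∉ys uniq-ys chain
  where
  inner : ∀ as bs → 2 ≤ length (as ++ w ∷ bs) → All (x ≢_) (as ++ w ∷ bs) → Unique (as ++ w ∷ bs) →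
    Chain _ (x ∷ (as ++ w ∷ bs) ++ [ x ]) → ∃ λ p → ∃ λ s → p ≢ s × _
  inner as bs long x∉ uniq chain with initLast as
  inner .[] []       (s≤s ()) x∉ uniq chain | []
  inner .[] (b ∷ bs) long (_ ∷ x≢b ∷ _) uniq (xw , wb , _) | [] = x , b , x≢b , trans (R-sym w x) xw , wb
  inner .(as ∷ʳ a) [] long x∉ uniq chain | as ∷ʳ′ a =
    a , x , All.lookup x∉ (∈-++⁺ˡ (∈-++⁺ʳ as (here refl))) ∘ sym , trans (R-sym w a) (proj₁ mid) , proj₂ mid
    where
    mid = chain-middle (x ∷ as) (subst (Chain _) (cong (x ∷_)
            (trans (++-assoc (as ∷ʳ a) (w ∷ []) (x ∷ [])) (++-assoc as (a ∷ []) (w ∷ x ∷ [])))) chain)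
  inner .(as ∷ʳ a) (b ∷ bs) long x∉ uniq chain | as ∷ʳ′ a =
    a , b , a≢b as uniq , trans (R-sym w a) (proj₁ mid) , proj₂ mid
    where
    mid = chain-middle (x ∷ as) (subst (Chain _) (cong (x ∷_)
            (trans (++-assoc (as ∷ʳ a) (w ∷ b ∷ bs) (x ∷ [])) (++-assoc as (a ∷ []) (w ∷ b ∷ bs ++ [ x ])))) chain)
    a≢b : ∀ as → Unique ((as ∷ʳ a) ++ w ∷ b ∷ bs) → a ≢ b
    a≢b []       ((_ ∷ a≢b ∷ _) ∷ _) = a≢b
    a≢b (_ ∷ as) (_ ∷ uniq)          = a≢b as uniq

module _ (G : Graph n) where

  singleton : Fin n → Tree G
  singleton a .V v = does (v ≟ a)
  singleton a .E _ _ = false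
  singleton a .E-sym _ _ = refl
  singleton a .E-sub _ _ ()
  singleton a .E-endsV _ _ ()
  singleton a .conn u v Vu Vv with u ≟ a | v ≟ a
  ... | yes refl | yes refl = here
  singleton a .acyclic (x , y ∷ ys , _ , _ , () , _)

  module _ (T : Tree G) {u w : Fin n} (Vu : V T u ≡ true) (Vw : V T w ≡ false) (uw : adj G u w ≡ true) where

    private
      new : Fin n → Fin n → Bool
      new s t = does (s ≟ u) ∧ does (t ≟ w)

      V⁺ : Fin n → Bool
      V⁺ v = does (v ≟ w) ∨ V T v

      E⁺ : Fin n → Fin n → Bool
      E⁺ s t = E T s t ∨ (new s t ∨ new t s)

      new-true : ∀ {s t} → new s t ≡ true → s ≡ u × t ≡ w
      new-true {s} {t} eq with s ≟ u | t ≟ w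
      ... | yes s≡u | yes t≡w = s≡u , t≡w

      E⁺-true : ∀ {s t} → E⁺ s t ≡ true → E T s t ≡ true ⊎ (s ≡ u × t ≡ w) ⊎ (s ≡ w × t ≡ u)
      E⁺-true {s} {t} eq with ∨-true {E T s t} eq
      ... | inj₁ st = inj₁ st
      ... | inj₂ nw with ∨-true {new s t} nw
      ...   | inj₁ st = inj₂ (inj₁ (new-true st))
      ...   | inj₂ ts = let t≡u , s≡w = new-true ts in inj₂ (inj₂ (s≡w , t≡u))

      old : ∀ {s t} → E T s t ≡ true → E⁺ s t ≡ true
      old {s} {t} st rewrite st = refl

      E⁺-uw : E⁺ u w ≡ true
      E⁺-uw rewrite dec-true (u ≟ u) refl | dec-true (w ≟ w) refl = ∨-zeroʳ _

      E⁺-sym : ∀ s t → E⁺ s t ≡ E⁺ t s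
      E⁺-sym s t = cong₂ _∨_ (E-sym T s t) (∨-comm (new s t) (new t s))

      V-w : ∀ {v} → V T v ≡ true → v ≢ w
      V-w Vv refl = contradiction (trans (sym Vv) Vw) λ ()

      E⁺-w : ∀ {t} → E⁺ w t ≡ true → t ≡ u
      E⁺-w {t} eq with E⁺-true eq
      ... | inj₁ wt                  = contradiction refl (V-w (E-endsV T w t wt))
      ... | inj₂ (inj₁ (w≡u , _))    = contradiction (sym w≡u) (V-w Vu)
      ... | inj₂ (inj₂ (_ , t≡u))    = t≡u

      walk⁺ : ∀ s t → V⁺ s ≡ true → V⁺ t ≡ true → Walk E⁺ s t
      walk⁺ s t V⁺s V⁺t with s ≟ w | t ≟ w
      ... | yes refl | yes refl = here
      ... | yes refl | no  _    = step (trans (E⁺-sym w u) E⁺-uw) (walk-map old (conn T u t Vu V⁺t))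
      ... | no  _    | yes refl = walk-++ (walk-map old (conn T s u V⁺s Vu)) (step E⁺-uw here)
      ... | no  _    | no  _    = walk-map old (conn T s t V⁺s V⁺t)

      avoiding : ∀ xs → w ∉ xs → Chain E⁺ xs → Chain (E T) xs
      avoiding []           _    _            = tt
      avoiding (x ∷ [])     _    _            = tt
      avoiding (x ∷ y ∷ xs) w∉xs (xy , chain) = xy-old , avoiding (y ∷ xs) (w∉xs ∘ there) chain
        where
        xy-old : E T x y ≡ true
        xy-old with E⁺-true xy
        ... | inj₁ old-edge          = old-edge
        ... | inj₂ (inj₁ (_ , y≡w))  = contradiction (there (here (sym y≡w))) w∉xs
        ... | inj₂ (inj₂ (x≡w , _))  = contradiction (here (sym x≡w)) w∉xs

    -- A cycle through the new leaf w would need two distinct neighbours of w.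
    add-leaf : Tree G
    add-leaf .V = V⁺
    add-leaf .E = E⁺
    add-leaf .E-sym = E⁺-sym
    add-leaf .E-sub s t eq with E⁺-true eq
    ... | inj₁ st                    = E-sub T s t st
    ... | inj₂ (inj₁ (refl , refl))  = uw
    ... | inj₂ (inj₂ (refl , refl))  = trans (adj-sym G w u) uw
    add-leaf .E-endsV s t eq with E⁺-true eq
    ... | inj₁ st                    = trans (cong (does (s ≟ w) ∨_) (E-endsV T s t st)) (∨-zeroʳ _)
    ... | inj₂ (inj₁ (refl , refl))  = trans (cong (does (u ≟ w) ∨_) Vu) (∨-zeroʳ _)
    ... | inj₂ (inj₂ (refl , refl))  rewrite dec-true (w ≟ w) refl = refl
    add-leaf .conn = walk⁺
    add-leaf .acyclic (x , ys , long , uniq , chain) =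
      acyclic T (x , ys , long , uniq , avoiding (x ∷ ys ++ [ x ]) w∉closed chain)
      where
      w∉ : w ∉ x ∷ ys
      w∉ w∈ with p , s , p≢s , wp , ws ← cycle-neighbours E⁺-sym long uniq chain w∈ =
        p≢s (trans (E⁺-w wp) (sym (E⁺-w ws)))
      w∉closed : w ∉ x ∷ ys ++ [ x ]
      w∉closed w∈ with ∈-++⁻ (x ∷ ys) w∈
      ... | inj₁ w∈′        = w∉ w∈′
      ... | inj₂ (here w≡x) = w∉ (here w≡x)

  module _ (F : Fin n → Fin n → Bool) (F-sym : ∀ s t → F s t ≡ F t s) (F-sub : ∀ s t → F s t ≡ true → adj G s t ≡ true) where

    Step : Fin n → Fin n → Set
    Step s t = F s t ≡ true

    -- `support` is what keeps trees of different colours apart: a vertex outside S in such a tree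
    -- has an end of the tree's colour, and all its ends have the same colour, so it cannot lie in
    -- the other tree.
    record Grown (a : Fin n) : Set where
      field
        tree    : Tree G
        root    : V tree a ≡ true
        edges   : ∀ s t → E tree s t ≡ true → F s t ≡ true
        support : ∀ v → V tree v ≡ true → v ≡ a ⊎ ∃ λ t → F v t ≡ true
    open Grown

    -- Follow the walk and hang each new vertex as a leaf on its predecessor, passing over vertices
    -- already present. The walk may repeat vertices and still every intermediate stage is a tree.
    grow : ∀ {a s t} (g : Grown a) → V (tree g) s ≡ true → Star Step s t →
      Σ (Grown a) λ h → (∀ v → V (tree g) v ≡ true → V (tree h) v ≡ true) × V (tree h) t ≡ true
    grow g Vs ε = g , (λ _ → id) , Vs
    grow {a} {s} g Vs (_◅_ {j = w} sw rest) with V (tree g) w in Vw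
    ... | true  = grow g Vw rest
    ... | false = let h , g′⊆h , Vt = grow g′ V⁺w rest in h , (λ v Vv → g′⊆h v (g⊆g′ v Vv)) , Vt
      where
      T′ : Tree G
      T′ = add-leaf (tree g) Vs Vw (F-sub s w sw)
      V⁺w : V T′ w ≡ true
      V⁺w rewrite dec-true (w ≟ w) refl = refl
      g⊆g′ : ∀ v → V (tree g) v ≡ true → V T′ v ≡ true
      g⊆g′ v Vv = trans (cong (does (v ≟ w) ∨_) Vv) (∨-zeroʳ _)
      g′ : Grown a
      g′ .tree = T′
      g′ .root = g⊆g′ a (root g)
      g′ .edges x y xy with ∨-true {E (tree g) x y} xy
      ... | inj₁ old = edges g x y old
      ... | inj₂ new with x ≟ s | y ≟ w | y ≟ s | x ≟ w
      ...   | yes refl | yes refl | _ | _ = sw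
      ...   | yes _ | no _ | yes refl | yes refl = trans (F-sym w s) sw
      ...   | no _ | _ | yes refl | yes refl = trans (F-sym w s) sw
      g′ .support v Vv with v ≟ w
      ... | yes refl = inj₂ (s , trans (F-sym w s) sw)
      ... | no  _    = support g v Vv

    spanning : ∀ {a b c} → Star Step a b → Star Step a c →
      Σ (Grown a) λ g → V (tree g) b ≡ true × V (tree g) c ≡ true
    spanning {a} a⇝b a⇝c =
      let g , _ , Vb    = grow start (dec-true (a ≟ a) refl) a⇝b
          h , g⊆h , Vc  = grow g (root g) a⇝c
      in h , g⊆h _ Vb , Vc
      where
      start : Grown a
      start .tree = singleton a
      start .root = dec-true (a ≟ a) refl
      start .edges _ _ ()
      start .support v Vv with v ≟ a
      ... | yes v≡a = inj₁ v≡a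

-- From coloured edge lists to graphs

lookup-injective : ∀ {xs : List A} → Unique xs → ∀ i j → lookup xs i ≡ lookup xs j → i ≡ j
lookup-injective (_ ∷ _)     zero    zero    _  = refl
lookup-injective (x∉xs ∷ _)  zero    (suc j) eq = contradiction eq (All.lookup x∉xs (∈-lookup j))
lookup-injective (x∉xs ∷ _)  (suc i) zero    eq = contradiction (sym eq) (All.lookup x∉xs (∈-lookup i))
lookup-injective (_ ∷ uniq)  (suc i) (suc j) eq = cong suc (lookup-injective uniq i j eq)

module _ {W : Set} where

  Adjacent : List (W × W) → W → W → Set
  Adjacent L p q = (p , q) ∈ L ⊎ (q , p) ∈ L

  -- χ p q is the colour given to the end at p of the edge pq; an edge belongs to tree i
  -- when both its ends have colour i.
  Coloured : List (W × W) → (W → W → Bool) → Bool → W → W → Set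
  Coloured L χ i p q = Adjacent L p q × χ p q ≡ i × χ q p ≡ i

  record Certificate (L : List (W × W)) (a b c : W) : Set where
    field
      χ    : W → W → Bool
      mono : ∀ {p} → p ≢ a → p ≢ b → p ≢ c → ∀ q r → χ p q ≡ χ p r
      a⇝b  : ∀ i → Star (Coloured L χ i) a b
      a⇝c  : ∀ i → Star (Coloured L χ i) a c

  Certified : List W → List (W × W) → Set
  Certified vs L = ∀ {a b c} → a ∈ vs → b ∈ vs → c ∈ vs → a ≢ b → a ≢ c → b ≢ c → Certificate L a b c

  module _ (_≟ᵥ_ : DecidableEquality W) {vs : List W} {L : List (W × W)} (vs-unique : Unique vs)
           (L⊆vs : ∀ {p q} → Adjacent L p q → p ∈ vs) where

    open DecMembership (≡-dec _≟ᵥ_ _≟ᵥ_) using (_∈?_)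

    private
      N = length vs

      ι : Fin N → W
      ι = lookup vs

      ι-injective : ∀ {i j} → ι i ≡ ι j → i ≡ j
      ι-injective = lookup-injective vs-unique _ _

      adjacent? : ∀ p q → Dec (Adjacent L p q)
      adjacent? p q = ((p , q) ∈? L) ⊎-dec ((q , p) ∈? L)

      distinct : Fin N → Fin N → Bool
      distinct i j = not (does (i ≟ j))

      adjᴸ : Fin N → Fin N → Bool
      adjᴸ i j = distinct i j ∧ does (adjacent? (ι i) (ι j))

      adjᴸ-intro : ∀ {i j} → i ≢ j → Adjacent L (ι i) (ι j) → adjᴸ i j ≡ true
      adjᴸ-intro {i} {j} i≢j ij rewrite dec-false (i ≟ j) i≢j = dec-true (adjacent? (ι i) (ι j)) ij

      adjᴸ-elim : ∀ {i j} → adjᴸ i j ≡ true → i ≢ j × Adjacent L (ι i) (ι j)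
      adjᴸ-elim {i} {j} eq with i ≟ j
      ... | no i≢j = i≢j , dec-true⁻ (adjacent? (ι i) (ι j)) eq

      adjᴸ-swap : ∀ {i j} → adjᴸ i j ≡ true → adjᴸ j i ≡ true
      adjᴸ-swap ij = let i≢j , ij′ = adjᴸ-elim ij in adjᴸ-intro (i≢j ∘ sym) (swap ij′)

      adjᴸ-sym : ∀ i j → adjᴸ i j ≡ adjᴸ j i
      adjᴸ-sym i j with adjᴸ i j in eq
      ... | true  = sym (adjᴸ-swap eq)
      ... | false = sym (¬-not λ ji → contradiction (trans (sym (adjᴸ-swap ji)) eq) λ ())

    graph : Graph N
    graph .adj = adjᴸ
    graph .adj-sym = adjᴸ-sym
    graph .adj-irr i rewrite dec-true (i ≟ i) refl = refl

    private
      joins : W × W → Fin N → Fin N → Set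
      joins (p , q) i j = toℕ i < toℕ j × ((ι i ≡ p × ι j ≡ q) ⊎ (ι i ≡ q × ι j ≡ p))

      joins? : ∀ pq i j → Dec (joins pq i j)
      joins? (p , q) i j = (toℕ i <? toℕ j) ×-dec
        (((ι i ≟ᵥ p) ×-dec (ι j ≟ᵥ q)) ⊎-dec ((ι i ≟ᵥ q) ×-dec (ι j ≟ᵥ p)))

      joins-functional : ∀ pq {i j i′ j′} → joins pq i j → joins pq i′ j′ → i ≡ i′ × j ≡ j′
      joins-functional _ (_ , inj₁ (refl , refl)) (_ , inj₁ (p , q)) = sym (ι-injective p) , sym (ι-injective q)
      joins-functional _ (_ , inj₂ (refl , refl)) (_ , inj₂ (p , q)) = sym (ι-injective p) , sym (ι-injective q)
      joins-functional _ (i<j , inj₁ (refl , refl)) (j<i , inj₂ (p , q))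
        with refl ← ι-injective p | refl ← ι-injective q = contradiction j<i (<-asym i<j)
      joins-functional _ (i<j , inj₂ (refl , refl)) (j<i , inj₁ (p , q))
        with refl ← ι-injective p | refl ← ι-injective q = contradiction j<i (<-asym i<j)

    -- Every edge `i < j` of the graph is joined by an entry of `L`, and an entry joins at most one
    -- such pair: the order on indices excludes its reversal.
    size≤ : e graph ≤ length L
    size≤ = begin
      e graph                                                                 ≤⟨ ∑²-mono joined ⟩
      ∑² (λ i j → ∑ L λ pq → ⟦ does (joins? pq i j) ⟧)                        ≡⟨ ∑-cong (allFin N) (λ i → ∑-swap (allFin N) L _) ⟩
      ∑ (allFin N) (λ i → ∑ L λ pq → ∑ (allFin N) λ j → ⟦ does (joins? pq i j) ⟧) ≡⟨ ∑-swap (allFin N) L _ ⟩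
      ∑ L (λ pq → ∑² λ i j → ⟦ does (joins? pq i j) ⟧)                        ≤⟨ ∑-mono L once ⟩
      ∑ L (λ _ → 1)                                                           ≡⟨ trans (∑-const L 1) (*-identityʳ _) ⟩
      length L                                                                ∎
      where
      open ≤-Reasoning
      hit : ∀ {i j} pq → pq ∈ L → joins pq i j → 1 ≤ ∑ L λ pq → ⟦ does (joins? pq i j) ⟧
      hit {i} {j} pq pq∈L J =
        ≤-trans (≤-reflexive (sym (cong ⟦_⟧ (dec-true (joins? pq i j) J)))) (∑-∈ _ pq∈L)

      joined : ∀ i j → ⟦ i ≺ j ∧ adjᴸ i j ⟧ ≤ ∑ L λ pq → ⟦ does (joins? pq i j) ⟧
      joined i j with i ≺ j ∧ adjᴸ i j in eq
      ... | false = z≤n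
      ... | true  with i≺j , ij ← ∧-true {i ≺ j} eq with adjᴸ-elim ij
      ...   | _ , inj₁ pq∈L = hit _ pq∈L (<ᵇ⇒< _ _ (Equivalence.from T-≡ i≺j) , inj₁ (refl , refl))
      ...   | _ , inj₂ qp∈L = hit _ qp∈L (<ᵇ⇒< _ _ (Equivalence.from T-≡ i≺j) , inj₂ (refl , refl))

      once : ∀ pq → (∑² λ i j → ⟦ does (joins? pq i j) ⟧) ≤ 1
      once pq = ∑-unique _ (Uniqueₚ.allFin⁺ N) row rows
        where
        hit⁻ : ∀ i j → 1 ≤ ⟦ does (joins? pq i j) ⟧ → joins pq i j
        hit⁻ i j = dec-true⁻ (joins? pq i j) ∘ 1≤⟦⟧
        row : ∀ i → ∑ (allFin N) (λ j → ⟦ does (joins? pq i j) ⟧) ≤ 1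
        row i = ∑-unique _ (Uniqueₚ.allFin⁺ N) (λ j → ⟦⟧≤1 _)
          λ j j′ Jj Jj′ → proj₂ (joins-functional pq (hit⁻ i j Jj) (hit⁻ i j′ Jj′))
        rows : ∀ i i′ → _ → _ → i ≡ i′
        rows i i′ Ji Ji′ =
          let j , Jj   = ∑-positive (allFin N) _ Ji
              j′ , Jj′ = ∑-positive (allFin N) _ Ji′
          in proj₁ (joins-functional pq (hit⁻ i j Jj) (hit⁻ i′ j′ Jj′))

    module _ {a b c : Fin N} (C : Certificate L (ι a) (ι b) (ι c)) where
      open Certificate C

      private
        is : Bool → Bool → Bool
        is i x = does (x Bool.≟ i)

        F : Bool → Fin N → Fin N → Bool
        F i s t = adjᴸ s t ∧ (is i (χ (ι s) (ι t)) ∧ is i (χ (ι t) (ι s)))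

        F-sym : ∀ i s t → F i s t ≡ F i t s
        F-sym i s t = cong₂ _∧_ (adjᴸ-sym s t) (∧-comm (is i (χ (ι s) (ι t))) _)

        F-sub : ∀ i s t → F i s t ≡ true → adjᴸ s t ≡ true
        F-sub i s t = proj₁ ∘ ∧-true {adjᴸ s t}

        F-colour : ∀ {i} s t → F i s t ≡ true → χ (ι s) (ι t) ≡ i
        F-colour {i} s t =
          dec-true⁻ (χ (ι s) (ι t) Bool.≟ i) ∘ proj₁ ∘ ∧-true {is i (χ (ι s) (ι t))} ∘ proj₂ ∘ ∧-true {adjᴸ s t}

        F-intro : ∀ {i s t} → s ≢ t → Coloured L χ i (ι s) (ι t) → F i s t ≡ true
        F-intro {i} {s} {t} s≢t (st , χst , χts) rewrite adjᴸ-intro s≢t st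
          | dec-true (χ (ι s) (ι t) Bool.≟ i) χst | dec-true (χ (ι t) (ι s) Bool.≟ i) χts = refl

        -- A step that stays at its vertex is dropped, because `adjᴸ` removes loops; every other
        -- step becomes an edge of the graph.
        pull : ∀ {i p v} → Star (Coloured L χ i) p v → ∀ s t → ι s ≡ p → ι t ≡ v →
          Star (Step graph (F i) (F-sym i) (F-sub i)) s t
        pull ε s t refl eq with refl ← ι-injective eq = ε
        pull {i} (_◅_ {j = q} pq@(adjacent , _) rest) s t refl eq = via (Any.index q∈vs) (Anyₚ.lookup-index q∈vs)
          where
          q∈vs : q ∈ vs
          q∈vs = L⊆vs (swap adjacent)
          via : ∀ u → q ≡ ι u → Star (Step graph (F i) (F-sym i) (F-sub i)) s t
          via u q≡u with s ≟ u
          ... | yes refl = pull rest s t (sym q≡u) eq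
          ... | no  s≢u  = F-intro s≢u (subst (Coloured L χ i (ι s)) q≡u pq) ◅ pull rest u t (sym q≡u) eq

        grown : ∀ i → _
        grown i = spanning graph (F i) (F-sym i) (F-sub i)
          (pull (a⇝b i) a b refl refl) (pull (a⇝c i) a c refl refl)

        colour : Fin 2 → Bool
        colour zero    = true
        colour (suc _) = false

        colour-injective : ∀ i j → colour i ≡ colour j → i ≡ j
        colour-injective zero       zero       _ = refl
        colour-injective (suc zero) (suc zero) _ = refl

        g : ∀ i → _
        g i = proj₁ (grown (colour i))

      open Grown

      two-trees : HasSTrees graph a b c 2
      two-trees = (λ i → tree (g i)) , contains , edge-disjoint , meet
        where
        contains : ∀ i → _
        contains i = root (g i) , proj₂ (grown (colour i))

        edge-disjoint : ∀ i j → i ≢ j → ∀ u v → E (tree (g i)) u v ≡ true → E (tree (g j)) u v ≡ false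
        edge-disjoint i j i≢j u v uvᵢ = ¬-not λ uvⱼ → i≢j (colour-injective i j
          (trans (sym (F-colour u v (edges (g i) u v uvᵢ))) (F-colour u v (edges (g j) u v uvⱼ))))

        meet : ∀ i j → i ≢ j → ∀ x → V (tree (g i)) x ≡ true → V (tree (g j)) x ≡ true → x ∈S[ a , b , c ]
        meet i j i≢j x Vᵢ Vⱼ with x ≟ a | x ≟ b | x ≟ c
        ... | yes x≡a | _ | _ = inj₁ x≡a
        ... | _ | yes x≡b | _ = inj₂ (inj₁ x≡b)
        ... | _ | _ | yes x≡c = inj₂ (inj₂ x≡c)
        ... | no x≢a | no x≢b | no x≢c with support (g i) x Vᵢ | support (g j) x Vⱼ
        ...   | inj₁ x≡a | _ = inj₁ x≡a
        ...   | _ | inj₁ x≡a = inj₁ x≡a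
        ...   | inj₂ (s , xs) | inj₂ (t , xt) = contradiction
                (colour-injective i j (trans (sym (F-colour x s xs))
                  (trans (mono (x≢a ∘ ι-injective) (x≢b ∘ ι-injective) (x≢c ∘ ι-injective) (ι s) (ι t))
                         (F-colour x t xt))))
                i≢j

    -- Only an upper bound on the number of edges is counted here. The reverse inequality is the
    -- lower bound `size-bound`, applied to the graph just constructed.
    extremal : Certified vs L → 4 ≤ N → length L ≤ ⌈ 6 * N /5⌉ →
      Σ (Graph N) λ G → κ₃≡2 G × e G ≡ ⌈ 6 * N /5⌉
    extremal certified 4≤N L≤ = graph , κ , ≤-antisym e≤ (size-bound graph κ)
      where
      e≤ : e graph ≤ ⌈ 6 * N /5⌉
      e≤ = ≤-trans size≤ L≤
      κ : κ₃≡2 graph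
      κ = κ₃≡2-from-size graph 4≤N
        (λ a b c (a≢b , a≢c , b≢c) → two-trees (certified (∈-lookup a) (∈-lookup b) (∈-lookup c)
          (a≢b ∘ ι-injective) (a≢c ∘ ι-injective) (b≢c ∘ ι-injective)))
        e≤

-- Checking certificates by computation

module _ {W : Set} where

  Coloured-sym : ∀ {L : List (W × W)} {χ i p q} → Coloured L χ i p q → Coloured L χ i q p
  Coloured-sym (pq , χpq , χqp) = swap pq , χqp , χpq

  swap₁₂ : ∀ {L : List (W × W)} {a b c} → Certificate L a b c → Certificate L b a c
  swap₁₂ C = record
    { χ    = χ
    ; mono = λ p≢b p≢a → mono p≢a p≢b
    ; a⇝b  = λ i → reverse (Coloured-sym {χ = χ}) (a⇝b i)
    ; a⇝c  = λ i → reverse (Coloured-sym {χ = χ}) (a⇝b i) ◅◅ a⇝c i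
    }
    where
    open Certificate C

  swap₂₃ : ∀ {L : List (W × W)} {a b c} → Certificate L a b c → Certificate L a c b
  swap₂₃ C = record
    { χ    = χ
    ; mono = λ p≢a p≢c p≢b → mono p≢a p≢b p≢c
    ; a⇝b  = a⇝c
    ; a⇝c  = a⇝b
    }
    where
    open Certificate C

  allPairs : (W → W → Bool) → List W → Bool
  allPairs f []       = true
  allPairs f (x ∷ xs) = all (f x) xs ∧ allPairs f xs

  allTriples : (W → W → W → Bool) → List W → Bool
  allTriples f []       = true
  allTriples f (x ∷ xs) = allPairs (f x) xs ∧ allTriples f xs

  allPairs-sound : {P : W → W → Set} (f : W → W → Bool) → (∀ {x y} → T (f x y) → P x y) →
    (∀ {x y} → P x y → P y x) → ∀ xs → T (allPairs f xs) →
    ∀ {x y} → x ∈ xs → y ∈ xs → x ≢ y → P x y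
  allPairs-sound {P} f sound P-sym (w ∷ ws) t = go
    where
    here-pairs : ∀ {z} → z ∈ ws → P w z
    here-pairs z∈ = sound (All.lookup (Allₚ.all⁺ (f w) ws (proj₁ (Equivalence.to T-∧ t))) z∈)
    go : ∀ {x y} → x ∈ w ∷ ws → y ∈ w ∷ ws → x ≢ y → P x y
    go (here refl) (here refl) x≢y = contradiction refl x≢y
    go (here refl) (there y∈)  x≢y = here-pairs y∈
    go (there x∈)  (here refl) x≢y = P-sym (here-pairs x∈)
    go (there x∈)  (there y∈)  x≢y =
      allPairs-sound f sound P-sym ws (proj₂ (Equivalence.to (T-∧ {all (f w) ws}) t)) x∈ y∈ x≢y

  -- Only triples in list order are evaluated; the transpositions `P₁₂` and `P₂₃` generate all
  -- rearrangements, a sixfold saving in the computation.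
  allTriples-sound : {P : W → W → W → Set} (f : W → W → W → Bool) → (∀ {x y z} → T (f x y z) → P x y z) →
    (∀ {x y z} → P x y z → P y x z) → (∀ {x y z} → P x y z → P x z y) → ∀ xs → T (allTriples f xs) →
    ∀ {x y z} → x ∈ xs → y ∈ xs → z ∈ xs → x ≢ y → x ≢ z → y ≢ z → P x y z
  allTriples-sound {P} f sound P₁₂ P₂₃ (w ∷ ws) t = go
    where
    here-triples : ∀ {y z} → y ∈ ws → z ∈ ws → y ≢ z → P w y z
    here-triples = allPairs-sound (f w) sound P₂₃ ws (proj₁ (Equivalence.to T-∧ t))
    go : ∀ {x y z} → x ∈ w ∷ ws → y ∈ w ∷ ws → z ∈ w ∷ ws → x ≢ y → x ≢ z → y ≢ z → P x y z
    go (here refl) (here refl) _           x≢y _   _   = contradiction refl x≢y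
    go (here refl) _           (here refl) _   x≢z _   = contradiction refl x≢z
    go _           (here refl) (here refl) _   _   y≢z = contradiction refl y≢z
    go (here refl) (there y∈)  (there z∈)  _   _   y≢z = here-triples y∈ z∈ y≢z
    go (there x∈)  (here refl) (there z∈)  _   x≢z _   = P₁₂ (here-triples x∈ z∈ x≢z)
    go (there x∈)  (there y∈)  (here refl) x≢y _   _   = P₂₃ (P₁₂ (here-triples x∈ y∈ x≢y))
    go (there x∈)  (there y∈)  (there z∈)  x≢y x≢z y≢z =
      allTriples-sound f sound P₁₂ P₂₃ ws (proj₂ (Equivalence.to (T-∧ {allPairs (f w) ws}) t)) x∈ y∈ z∈ x≢y x≢z y≢z

  module Check (_==_ : W → W → Bool) (==⇒≡ : ∀ {p q} → T (p == q) → p ≡ q) (L : List (W × W)) where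

    _∈ᵇ_ : W → List W → Bool
    p ∈ᵇ []       = false
    p ∈ᵇ (q ∷ qs) = (p == q) ∨ p ∈ᵇ qs

    ∈ᵇ-lookup : ∀ {P : W → Set} {p qs} → T (p ∈ᵇ qs) → All P qs → P p
    ∈ᵇ-lookup {P} {p} {q ∷ _} t (Pq ∷ Pqs) with Equivalence.to (T-∨ {p == q}) t
    ... | inj₁ p=q = subst P (sym (==⇒≡ p=q)) Pq
    ... | inj₂ t′  = ∈ᵇ-lookup t′ Pqs

    ≢⇒== : ∀ {p q} → p ≢ q → (p == q) ≡ false
    ≢⇒== p≢q = ¬-not (p≢q ∘ ==⇒≡ ∘ Equivalence.from T-≡)

    sweep : List (W × W) → List W → List W
    sweep []             seen = seen
    sweep ((p , q) ∷ es) seen = sweep es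
      (if p ∈ᵇ seen then (if q ∈ᵇ seen then seen else q ∷ seen)
                    else (if q ∈ᵇ seen then p ∷ seen else seen))

    -- Sweeps are repeated until one adds nothing. `extend-by` takes the swept list as an argument
    -- so that the comparison of lengths and the recursive call share it.
    reach : ℕ → List (W × W) → List W → List W
    extend-by : ℕ → List (W × W) → List W → List W → List W
    reach zero       es seen = seen
    reach (suc fuel) es seen = extend-by fuel es seen (sweep es seen)
    extend-by fuel es seen seen′ = if length seen′ ≡ᵇ length seen then seen else reach fuel es seen′

    module _ {R : W → W → Set} {a : W} where

      sweep-sound : ∀ {es seen} → All (λ (p , q) → R p q × R q p) es → All (Star R a) seen → All (Star R a) (sweep es seen)
      sweep-sound [] ok = ok
      sweep-sound {(p , q) ∷ es} {seen} ((pq , qp) ∷ rest) ok with p ∈ᵇ seen in p∈ | q ∈ᵇ seen in q∈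
      ... | true  | true  = sweep-sound rest ok
      ... | true  | false = sweep-sound rest ((∈ᵇ-lookup (Equivalence.from T-≡ p∈) ok ◅◅ (pq ◅ ε)) ∷ ok)
      ... | false | true  = sweep-sound rest ((∈ᵇ-lookup (Equivalence.from T-≡ q∈) ok ◅◅ (qp ◅ ε)) ∷ ok)
      ... | false | false = sweep-sound rest ok

      reach-sound : ∀ fuel {es seen} → All (λ (p , q) → R p q × R q p) es → All (Star R a) seen → All (Star R a) (reach fuel es seen)
      reach-sound zero       good ok = ok
      reach-sound (suc fuel) {es} {seen} good ok with length (sweep es seen) ≡ᵇ length seen
      ... | true  = ok
      ... | false = reach-sound fuel good (sweep-sound good ok)

    module _ (a b c : W) (M : List W) where

      isS : W → Bool
      isS p = (p == a) ∨ ((p == b) ∨ (p == c))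

      -- A set M of vertices gives every end at a vertex outside S = {a,b,c} the colour of that
      -- vertex; the colour of an end in S is copied from the other end, and an edge inside S is
      -- coloured true when both its ends are in M.
      χᴹ : W → W → Bool
      χᴹ p q = if isS p then (if isS q then p ∈ᵇ M ∧ q ∈ᵇ M else q ∈ᵇ M) else p ∈ᵇ M

      mono : ∀ {p} → p ≢ a → p ≢ b → p ≢ c → ∀ q r → χᴹ p q ≡ χᴹ p r
      mono {p} p≢a p≢b p≢c q r rewrite ≢⇒== p≢a | ≢⇒== p≢b | ≢⇒== p≢c = refl

      used : Bool → W × W → Bool
      used i (p , q) = does (χᴹ p q Bool.≟ i) ∧ does (χᴹ q p Bool.≟ i)

      component : Bool → List W
      -- The fuel 8 limits only completeness: by `reach-sound` all listed vertices are reachable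
      -- whatever the fuel, and too small a value could only make the check return `false`.
      component i = reach 8 (filterᵇ (used i) L) (a ∷ [])

      joined : Bool → Bool
      joined i = b ∈ᵇ component i ∧ c ∈ᵇ component i

      certifies : Bool
      certifies = joined true ∧ joined false

      good : ∀ i (es : List (W × W)) → (∀ {pq} → pq ∈ es → pq ∈ L) →
        All (λ (p , q) → Coloured L χᴹ i p q × Coloured L χᴹ i q p) (filterᵇ (used i) es)
      good i []             es⊆L = []
      good i ((p , q) ∷ es) es⊆L with χᴹ p q Bool.≟ i | χᴹ q p Bool.≟ i
      ... | yes χpq | yes χqp = (pq , Coloured-sym {χ = χᴹ} pq) ∷ good i es (es⊆L ∘ there)
        where
        pq : Coloured L χᴹ i p q
        pq = inj₁ (es⊆L (here refl)) , χpq , χqp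
      ... | yes _   | no  _   = good i es (es⊆L ∘ there)
      ... | no  _   | _       = good i es (es⊆L ∘ there)

      certificate : T certifies → Certificate L a b c
      certificate t = record { χ = χᴹ ; mono = mono ; a⇝b = proj₁ ∘ both ; a⇝c = proj₂ ∘ both }
        where
        split : ∀ {x y} → T (x ∧ y) → T x × T y
        split = Equivalence.to T-∧
        t-joined : ∀ i → T (joined i)
        t-joined true  = proj₁ (split t)
        t-joined false = proj₂ (split {joined true} t)
        both : ∀ i → Star (Coloured L χᴹ i) a b × Star (Coloured L χᴹ i) a c
        both i = ∈ᵇ-lookup (proj₁ (split (t-joined i))) seen , ∈ᵇ-lookup (proj₂ (split {b ∈ᵇ component i} (t-joined i))) seen
          where
          seen : All (Star (Coloured L χᴹ i) a) (component i)
          seen = reach-sound 8 (good i L id) (ε ∷ [])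

    check : List (List W) → W → W → W → Bool
    check Ms a b c = any (certifies a b c) Ms

    certified : ∀ Ms vs → allTriples (check Ms) vs ≡ true → Certified vs L
    certified Ms vs eq = allTriples-sound (check Ms) sound swap₁₂ swap₂₃ vs (Equivalence.from T-≡ eq)
      where
      sound : ∀ {a b c} → T (check Ms a b c) → Certificate L a b c
      sound {a} {b} {c} t with M , ok ← Any.satisfied (Anyₚ.any⁻ (certifies a b c) Ms t) = certificate a b c M ok

-- Column c of the subdivided Möbius ladder has branch vertices top and bottom, and midpoints
-- of its rung and of the rails leaving top and bottom towards column c + 1. The rails cross
-- between the last column and column 0.
data Kind : Set where
  top bottom rung upper lower : Kind

code : Kind → ℕ
code top    = 0
code bottom = 1
code rung   = 2
code upper  = 3
code lower  = 4

code-injective : ∀ {k l} → code k ≡ code l → k ≡ l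
code-injective {top}    {top}    _ = refl
code-injective {bottom} {bottom} _ = refl
code-injective {rung}   {rung}   _ = refl
code-injective {upper}  {upper}  _ = refl
code-injective {lower}  {lower}  _ = refl

Vertex : Set
Vertex = ℕ × Kind

_≟ₖ_ : DecidableEquality Kind
k ≟ₖ l = map′ code-injective (cong code) (code k ℕ.≟ code l)

_≟ᵥ_ : DecidableEquality Vertex
_≟ᵥ_ = ≡-dec ℕ._≟_ _≟ₖ_

_==ᵥ_ : Vertex → Vertex → Bool
(c , k) ==ᵥ (d , l) = (c ≡ᵇ d) ∧ (code k ≡ᵇ code l)

==ᵥ⇒≡ : ∀ {p q} → T (p ==ᵥ q) → p ≡ q
==ᵥ⇒≡ {c , k} {d , l} t = let c=d , k=l = Equivalence.to (T-∧ {c ≡ᵇ d}) t in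
  cong₂ _,_ (≡ᵇ⇒≡ c d c=d) (code-injective (≡ᵇ⇒≡ (code k) (code l) k=l))

flip : Kind → Kind
flip top    = bottom
flip bottom = top
flip rung   = rung
flip upper  = lower
flip lower  = upper

-- The rotation by one column, an automorphism of the ladder. The crossing makes its `m`-th power
-- equal to `flip` on the first `m` columns.
next : ℕ → Vertex → Vertex
next m (c , k) = if suc c ≡ᵇ m then (0 , flip k) else (suc c , k)

-- The two ends of the edge that a midpoint subdivides; on the branch kinds the catch-all clauses of
-- `end₁` and `end₂` give default values.
end₁ : Vertex → Vertex
end₁ (c , lower) = c , bottom
end₁ (c , _)     = c , top

end₂ : ℕ → Vertex → Vertex
end₂ m (c , upper) = next m (c , top)
end₂ m (c , lower) = next m (c , bottom)
end₂ m (c , _)     = c , bottom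

mids branches : ℕ → List Vertex
mids m     = cartesianProduct (upTo m) (rung ∷ upper ∷ lower ∷ [])
branches m = cartesianProduct (upTo m) (top ∷ bottom ∷ [])

short : ℕ → Vertex → Vertex × Vertex
short m w = end₁ w , end₂ m w

halves : ℕ → Vertex → List (Vertex × Vertex)
halves m w = (end₁ w , w) ∷ (w , end₂ m w) ∷ []

-- The first j midpoints are suppressed.
vertices : ℕ → ℕ → List Vertex
vertices m j = drop j (mids m) ++ branches m

edges : ℕ → ℕ → List (Vertex × Vertex)
edges m j = map (short m) (take j (mids m)) ++ concatMap (halves m) (drop j (mids m))

-- Found by computer search: every triple of vertices is served by one of these 19 sets.
masks₃ : List (List Vertex)
masks₃ =
  ((0 , bottom) ∷ (0 , lower) ∷ (1 , bottom) ∷ (1 , rung) ∷ (1 , lower) ∷ (2 , bottom) ∷ (2 , upper) ∷ (2 , lower) ∷ [])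
  ∷ ((0 , bottom) ∷ (0 , rung) ∷ (1 , lower) ∷ (2 , top) ∷ (2 , bottom) ∷ (2 , rung) ∷ (2 , upper) ∷ [])
  ∷ ((0 , top) ∷ (0 , bottom) ∷ (0 , rung) ∷ (0 , upper) ∷ (0 , lower) ∷ (2 , bottom) ∷ (2 , rung) ∷ (2 , lower) ∷ [])
  ∷ ((0 , top) ∷ (0 , upper) ∷ (1 , bottom) ∷ (1 , rung) ∷ (1 , lower) ∷ (2 , bottom) ∷ (2 , lower) ∷ [])
  ∷ ((0 , top) ∷ (0 , rung) ∷ (1 , upper) ∷ (1 , lower) ∷ (2 , top) ∷ (2 , bottom) ∷ (2 , rung) ∷ (2 , lower) ∷ [])
  ∷ ((1 , top) ∷ (1 , bottom) ∷ (1 , rung) ∷ (1 , upper) ∷ (1 , lower) ∷ (2 , bottom) ∷ (2 , lower) ∷ [])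
  ∷ ((1 , top) ∷ (1 , rung) ∷ (1 , upper) ∷ (1 , lower) ∷ (2 , top) ∷ (2 , bottom) ∷ (2 , rung) ∷ (2 , upper) ∷ (2 , lower) ∷ [])
  ∷ ((0 , top) ∷ (0 , upper) ∷ (1 , top) ∷ (1 , upper) ∷ (2 , bottom) ∷ (2 , rung) ∷ (2 , lower) ∷ [])
  ∷ ((0 , lower) ∷ (1 , bottom) ∷ (1 , lower) ∷ (2 , top) ∷ (2 , bottom) ∷ (2 , rung) ∷ (2 , upper) ∷ (2 , lower) ∷ [])
  ∷ ((0 , top) ∷ (0 , bottom) ∷ (0 , rung) ∷ (0 , lower) ∷ (1 , bottom) ∷ (1 , rung) ∷ (1 , lower) ∷ (2 , upper) ∷ (2 , lower) ∷ [])
  ∷ ((0 , top) ∷ (0 , upper) ∷ (0 , lower) ∷ (1 , bottom) ∷ (1 , lower) ∷ (2 , bottom) ∷ (2 , rung) ∷ (2 , lower) ∷ [])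
  ∷ ((0 , bottom) ∷ (0 , rung) ∷ (0 , upper) ∷ (0 , lower) ∷ (1 , top) ∷ (1 , bottom) ∷ (1 , rung) ∷ (1 , upper) ∷ (1 , lower) ∷ (2 , bottom) ∷ (2 , rung) ∷ (2 , upper) ∷ (2 , lower) ∷ [])
  ∷ ((0 , top) ∷ (0 , upper) ∷ (0 , lower) ∷ (1 , bottom) ∷ (1 , rung) ∷ (1 , upper) ∷ (1 , lower) ∷ (2 , top) ∷ (2 , bottom) ∷ (2 , rung) ∷ (2 , upper) ∷ (2 , lower) ∷ [])
  ∷ ((0 , top) ∷ (0 , rung) ∷ (0 , upper) ∷ (1 , top) ∷ (1 , rung) ∷ (1 , upper) ∷ (1 , lower) ∷ (2 , bottom) ∷ (2 , lower) ∷ [])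
  ∷ ((0 , top) ∷ (0 , bottom) ∷ (0 , rung) ∷ (0 , upper) ∷ (0 , lower) ∷ (1 , top) ∷ (1 , rung) ∷ (1 , lower) ∷ (2 , bottom) ∷ (2 , upper) ∷ (2 , lower) ∷ [])
  ∷ ((0 , top) ∷ (0 , rung) ∷ (0 , upper) ∷ (1 , top) ∷ (1 , bottom) ∷ (1 , rung) ∷ (1 , upper) ∷ (1 , lower) ∷ (2 , top) ∷ (2 , rung) ∷ (2 , upper) ∷ (2 , lower) ∷ [])
  ∷ ((0 , top) ∷ (0 , rung) ∷ (0 , upper) ∷ (1 , lower) ∷ (2 , top) ∷ (2 , bottom) ∷ (2 , rung) ∷ (2 , upper) ∷ (2 , lower) ∷ [])
  ∷ ((0 , upper) ∷ (0 , lower) ∷ (1 , top) ∷ (1 , bottom) ∷ (1 , rung) ∷ (1 , lower) ∷ (2 , bottom) ∷ (2 , rung) ∷ (2 , lower) ∷ [])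
  ∷ ((0 , bottom) ∷ (0 , rung) ∷ (1 , upper) ∷ (2 , top) ∷ (2 , bottom) ∷ (2 , rung) ∷ (2 , upper) ∷ (2 , lower) ∷ [])
  ∷ []
-- The Möbius ladder with three rungs is `K₃,₃`. Its full subdivision has 15 vertices, so 455
-- triples are evaluated.
base₃ : Certified (vertices 3 0) (edges 3 0)
base₃ = Check.certified _==ᵥ_ ==ᵥ⇒≡ (edges 3 0) masks₃ (vertices 3 0) refl

-- Möbius ladders of arbitrary length

module _ {W X : Set} {L : List (W × W)} {L′ : List (X × X)} where

  -- Common form of inserting a column, rotating and suppressing a vertex. An edge may turn into a
  -- longer walk under insertion or shrink to a point under suppression, hence `Star` in the
  -- hypothesis on edges.
  transport : ∀ {a b c} (f : W → X) (C : Certificate L a b c) (χ′ : X → X → Bool) →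
    (∀ {p} → p ≢ f a → p ≢ f b → p ≢ f c → ∀ q r → χ′ p q ≡ χ′ p r) →
    (∀ {i p q} → (p , q) ∈ L → Certificate.χ C p q ≡ i → Certificate.χ C q p ≡ i →
      Star (Coloured L′ χ′ i) (f p) (f q)) →
    Certificate L′ (f a) (f b) (f c)
  transport f C χ′ mono′ path = record
    { χ    = χ′
    ; mono = mono′
    ; a⇝b  = λ i → kleisliStar f lift-edge (a⇝b i)
    ; a⇝c  = λ i → kleisliStar f lift-edge (a⇝c i)
    }
    where
    open Certificate C
    lift-edge : ∀ {i p q} → Coloured L χ i p q → Star (Coloured L′ χ′ i) (f p) (f q)
    lift-edge (inj₁ pq , χpq , χqp) = path pq χpq χqp
    lift-edge (inj₂ qp , χpq , χqp) = reverse (Coloured-sym {χ = χ′}) (path qp χqp χpq)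

-- `edges m 0` as a relation. The crossing has constructors of its own, so that case analysis takes
-- the place of evaluating `next`.
data Half (m : ℕ) : Vertex → Vertex → Set where
  rung₁  : ∀ {c} → c < m → Half m (c , top) (c , rung)
  rung₂  : ∀ {c} → c < m → Half m (c , rung) (c , bottom)
  upper₁ : ∀ {c} → c < m → Half m (c , top) (c , upper)
  upper₂ : ∀ {c} → suc c < m → Half m (c , upper) (suc c , top)
  upper₃ : ∀ {c} → suc c ≡ m → Half m (c , upper) (0 , bottom)
  lower₁ : ∀ {c} → c < m → Half m (c , bottom) (c , lower)
  lower₂ : ∀ {c} → suc c < m → Half m (c , lower) (suc c , bottom)
  lower₃ : ∀ {c} → suc c ≡ m → Half m (c , lower) (0 , top)

≡ᵇ-refl : ∀ m → (m ≡ᵇ m) ≡ true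
≡ᵇ-refl m = Equivalence.to T-≡ (≡⇒≡ᵇ m m refl)

≢⇒≡ᵇ : ∀ {m n} → m ≢ n → (m ≡ᵇ n) ≡ false
≢⇒≡ᵇ {m} {n} m≢n = ¬-not (m≢n ∘ ≡ᵇ⇒≡ m n ∘ Equivalence.from T-≡)

next-last : ∀ {m c} k → suc c ≡ m → next m (c , k) ≡ (0 , flip k)
next-last {m} k refl rewrite ≡ᵇ-refl m = refl

next-inner : ∀ {m c} k → suc c < m → next m (c , k) ≡ (suc c , k)
next-inner k c<m rewrite ≢⇒≡ᵇ (<⇒≢ c<m) = refl

∈-halves₁ : ∀ {m w ws} → w ∈ ws → (end₁ w , w) ∈ concatMap (halves m) ws
∈-halves₁ {m} w∈ = ∈-concatMap⁺ (halves m) (Any.map (λ { refl → here refl }) w∈)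

∈-halves₂ : ∀ {m w ws} → w ∈ ws → (w , end₂ m w) ∈ concatMap (halves m) ws
∈-halves₂ {m} w∈ = ∈-concatMap⁺ (halves m) (Any.map (λ { refl → there (here refl) }) w∈)

∈-halves⁻ : ∀ {m ws e} → e ∈ concatMap (halves m) ws →
  ∃ λ w → w ∈ ws × (e ≡ (end₁ w , w) ⊎ e ≡ (w , end₂ m w))
∈-halves⁻ {ws = w ∷ _} (here refl)         = w , here refl , inj₁ refl
∈-halves⁻ {ws = w ∷ _} (there (here refl)) = w , here refl , inj₂ refl
∈-halves⁻ {ws = _ ∷ _} (there (there e∈))  = let w , w∈ , ends = ∈-halves⁻ e∈ in w , there w∈ , ends

∈-mids : ∀ {m c k} → c < m → k ∈ rung ∷ upper ∷ lower ∷ [] → (c , k) ∈ mids m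
∈-mids c<m k∈ = ∈-cartesianProduct⁺ (∈-upTo⁺ c<m) k∈

∈-branches : ∀ {m c k} → c < m → k ∈ top ∷ bottom ∷ [] → (c , k) ∈ branches m
∈-branches c<m k∈ = ∈-cartesianProduct⁺ (∈-upTo⁺ c<m) k∈

mids⇒< : ∀ {m w} → w ∈ mids m → proj₁ w < m
mids⇒< {m} w∈ = ∈-upTo⁻ (proj₁ (∈-cartesianProduct⁻ (upTo m) _ w∈))

branches⇒< : ∀ {m w} → w ∈ branches m → proj₁ w < m
branches⇒< {m} w∈ = ∈-upTo⁻ (proj₁ (∈-cartesianProduct⁻ (upTo m) _ w∈))

vertices⇒< : ∀ {m w} → w ∈ vertices m 0 → proj₁ w < m
vertices⇒< {m} w∈ = [ mids⇒< , branches⇒< ]′ (∈-++⁻ (mids m) w∈)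

<⇒vertices : ∀ {m} w → proj₁ w < m → w ∈ vertices m 0
<⇒vertices {m} (c , top)    c<m = ∈-++⁺ʳ (mids m) (∈-branches c<m (here refl))
<⇒vertices {m} (c , bottom) c<m = ∈-++⁺ʳ (mids m) (∈-branches c<m (there (here refl)))
<⇒vertices     (c , rung)   c<m = ∈-++⁺ˡ (∈-mids c<m (here refl))
<⇒vertices     (c , upper)  c<m = ∈-++⁺ˡ (∈-mids c<m (there (here refl)))
<⇒vertices     (c , lower)  c<m = ∈-++⁺ˡ (∈-mids c<m (there (there (here refl))))

edge⇒half : ∀ {m p q} → (p , q) ∈ edges m 0 → Half m p q
edge⇒half {m} pq∈ with w@(c , k) , w∈ , ends ← ∈-halves⁻ {ws = mids m} pq∈ =
  half k (proj₂ (∈-cartesianProduct⁻ (upTo m) _ w∈)) (mids⇒< w∈) ends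
  where
  half : ∀ {m c p q} k → k ∈ rung ∷ upper ∷ lower ∷ [] → c < m →
    (p , q) ≡ (end₁ (c , k) , (c , k)) ⊎ (p , q) ≡ ((c , k) , end₂ m (c , k)) → Half m p q
  half rung  _ c<m (inj₁ refl) = rung₁ c<m
  half rung  _ c<m (inj₂ refl) = rung₂ c<m
  half upper _ c<m (inj₁ refl) = upper₁ c<m
  half {m} {c} upper _ c<m (inj₂ refl) with suc c ℕ.≟ m
  ... | yes sc≡m = subst (Half m (c , upper)) (sym (next-last top sc≡m)) (upper₃ sc≡m)
  ... | no  sc≢m = subst (Half m (c , upper)) (sym (next-inner top (≤∧≢⇒< c<m sc≢m))) (upper₂ (≤∧≢⇒< c<m sc≢m))
  half lower _ c<m (inj₁ refl) = lower₁ c<m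
  half {m} {c} lower _ c<m (inj₂ refl) with suc c ℕ.≟ m
  ... | yes sc≡m = subst (Half m (c , lower)) (sym (next-last bottom sc≡m)) (lower₃ sc≡m)
  ... | no  sc≢m = subst (Half m (c , lower)) (sym (next-inner bottom (≤∧≢⇒< c<m sc≢m))) (lower₂ (≤∧≢⇒< c<m sc≢m))
  half top    (there (there (there ()))) _ _
  half bottom (there (there (there ()))) _ _

half⇒edge : ∀ {m p q} → Half m p q → (p , q) ∈ edges m 0
half⇒edge (rung₁ c<m)  = ∈-halves₁ (∈-mids c<m (here refl))
half⇒edge (rung₂ c<m)  = ∈-halves₂ (∈-mids c<m (here refl))
half⇒edge (upper₁ c<m) = ∈-halves₁ (∈-mids c<m (there (here refl)))
half⇒edge {m} {p} (upper₂ sc<m) = subst (λ q → (p , q) ∈ edges m 0) (next-inner top sc<m)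
  (∈-halves₂ (∈-mids (<⇒≤ sc<m) (there (here refl))))
half⇒edge {m} {p} (upper₃ sc≡m) = subst (λ q → (p , q) ∈ edges m 0) (next-last top sc≡m)
  (∈-halves₂ (∈-mids (≤-reflexive sc≡m) (there (here refl))))
half⇒edge (lower₁ c<m) = ∈-halves₁ (∈-mids c<m (there (there (here refl))))
half⇒edge {m} {p} (lower₂ sc<m) = subst (λ q → (p , q) ∈ edges m 0) (next-inner bottom sc<m)
  (∈-halves₂ (∈-mids (<⇒≤ sc<m) (there (there (here refl)))))
half⇒edge {m} {p} (lower₃ sc≡m) = subst (λ q → (p , q) ∈ edges m 0) (next-last bottom sc≡m)
  (∈-halves₂ (∈-mids (≤-reflexive sc≡m) (there (there (here refl)))))

shift : Vertex → Vertex
shift (c , k) = suc c , k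

module _ (l : ℕ) {a b c : Vertex} (C : Certificate (edges (suc l) 0) a b c) where
  open Certificate C

  private
    m = suc l

    -- The ends at the inserted column take the colour of the rail half-edge they subdivide ...
    through : Kind → Bool
    through top    = χ (l , lower) (0 , top)
    through upper  = χ (l , lower) (0 , top)
    through bottom = χ (l , upper) (0 , bottom)
    through lower  = χ (l , upper) (0 , bottom)
    through rung   = true

    -- ... and seen from outside, its vertices stand for the far end of that half-edge.
    beyond : Kind → Vertex
    beyond top    = 0 , top
    beyond bottom = 0 , bottom
    beyond upper  = l , lower
    beyond lower  = l , upper
    beyond rung   = 0 , rung

    old : Vertex → Vertex
    old (zero , k)  = beyond k
    old (suc c , k) = c , k

    χ⁺ : Vertex → Vertex → Bool
    χ⁺ (zero , k)  q = through k
    χ⁺ (suc c , k) q = χ (c , k) (old q)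

    mono⁺ : ∀ {p} → p ≢ shift a → p ≢ shift b → p ≢ shift c → ∀ q r → χ⁺ p q ≡ χ⁺ p r
    mono⁺ {zero , _}  _   _   _   q r = refl
    mono⁺ {suc _ , _} p≢a p≢b p≢c q r = mono (p≢a ∘ cong shift) (p≢b ∘ cong shift) (p≢c ∘ cong shift) (old q) (old r)

    infixr 5 _∙_
    _∙_ : ∀ {i p q r} → Half (suc m) p q × χ⁺ p q ≡ i × χ⁺ q p ≡ i →
      Star (Coloured (edges (suc m) 0) χ⁺ i) q r → Star (Coloured (edges (suc m) 0) χ⁺ i) p r
    (h , χpq , χqp) ∙ rest = (inj₁ (half⇒edge h) , χpq , χqp) ◅ rest

    path : ∀ {i p q} → Half m p q → χ p q ≡ i → χ q p ≡ i →
      Star (Coloured (edges (suc m) 0) χ⁺ i) (shift p) (shift q)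
    path (rung₁ c<m)   x y = (rung₁ (s≤s c<m) , x , y) ∙ ε
    path (rung₂ c<m)   x y = (rung₂ (s≤s c<m) , x , y) ∙ ε
    path (upper₁ c<m)  x y = (upper₁ (s≤s c<m) , x , y) ∙ ε
    path (upper₂ c<m)  x y = (upper₂ (s≤s c<m) , x , y) ∙ ε
    -- The half-edge over the crossing becomes three half-edges through the inserted column. Both
    -- new vertices carry the colour of its end at `upper`, so `x` settles every end except the
    -- last, where the old end at `bottom` gives `y`.
    path (upper₃ refl) x y =
      (upper₃ refl , x , x) ∙ (lower₁ (s≤s z≤n) , x , x) ∙ (lower₂ (s≤s (s≤s z≤n)) , x , y) ∙ ε
    path (lower₁ c<m)  x y = (lower₁ (s≤s c<m) , x , y) ∙ ε
    path (lower₂ c<m)  x y = (lower₂ (s≤s c<m) , x , y) ∙ ε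
    path (lower₃ refl) x y =
      (lower₃ refl , x , x) ∙ (upper₁ (s≤s z≤n) , x , x) ∙ (upper₂ (s≤s (s≤s z≤n)) , x , y) ∙ ε

  insert-column : Certificate (edges (suc m) 0) (shift a) (shift b) (shift c)
  insert-column = transport shift C χ⁺ mono⁺ (path ∘ edge⇒half)

-- Rotating the Möbius ladder

flip-flip : ∀ k → flip (flip k) ≡ k
flip-flip top    = refl
flip-flip bottom = refl
flip-flip rung   = refl
flip-flip upper  = refl
flip-flip lower  = refl

prev : ℕ → Vertex → Vertex
prev l (zero , k)  = l , flip k
prev l (suc c , k) = c , k

next-prev : ∀ l v → proj₁ v < suc l → next (suc l) (prev l v) ≡ v
next-prev l (zero , k)  _   = trans (next-last {suc l} {l} (flip k) refl) (cong (0 ,_) (flip-flip k))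
next-prev l (suc c , k) c<l = next-inner k c<l

prev-next : ∀ l v → proj₁ v < suc l → prev l (next (suc l) v) ≡ v
prev-next l (c , k) c<l with suc c ℕ.≟ suc l
... | yes refl = trans (cong (prev l) (next-last {suc l} {l} k refl)) (cong (l ,_) (flip-flip k))
... | no  c≢l  = cong (prev l) (next-inner k (≤∧≢⇒< c<l c≢l))

-- Passing the crossing exchanges top and bottom and thereby reverses the two halves of a rung, so
-- the conclusion is `Adjacent`, without orientation. At least two columns ensure that column 0 is
-- not the last, so that its rails lead to column 1.
half-next : ∀ {l p q} → Half (2 + l) p q → Adjacent (edges (2 + l) 0) (next (2 + l) p) (next (2 + l) q)
half-next {l} = go
  where
  m = 2 + l
  Adj : Vertex → Vertex → Set
  Adj = Adjacent (edges m 0)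
  column : ∀ {c k k′} → c < m → Adj (0 , flip k) (0 , flip k′) → (suc c < m → Adj (suc c , k) (suc c , k′)) → Adj (next m (c , k)) (next m (c , k′))
  column {c} {k} {k′} c<m wrap inner with suc c ℕ.≟ m
  ... | yes sc≡m = subst₂ Adj (sym (next-last k sc≡m)) (sym (next-last k′ sc≡m)) wrap
  ... | no  sc≢m = let sc<m = ≤∧≢⇒< c<m sc≢m in
                   subst₂ Adj (sym (next-inner k sc<m)) (sym (next-inner k′ sc<m)) (inner sc<m)
  rail : ∀ {c k k′} → suc c < m → (2 + c ≡ m → Adj (suc c , k) (0 , flip k′)) → (2 + c < m → Adj (suc c , k) (2 + c , k′)) →
    Adj (next m (c , k)) (next m (suc c , k′))
  rail {c} {k} {k′} sc<m wrap inner with 2 + c ℕ.≟ m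
  ... | yes eq = subst₂ Adj (sym (next-inner k sc<m)) (sym (next-last k′ eq)) (wrap eq)
  ... | no neq = let ssc<m = ≤∧≢⇒< sc<m neq in
                 subst₂ Adj (sym (next-inner k sc<m)) (sym (next-inner k′ ssc<m)) (inner ssc<m)
  half : ∀ {p q} → Half m p q → Adj p q
  half h = inj₁ (half⇒edge h)
  0<m : 0 < m
  0<m = s≤s z≤n
  1<m : 1 < m
  1<m = s≤s (s≤s z≤n)
  go : ∀ {p q} → Half m p q → Adj (next m p) (next m q)
  go (rung₁ c<m)   = column c<m (swap (half (rung₂ 0<m))) (half ∘ rung₁)
  go (rung₂ c<m)   = column c<m (swap (half (rung₁ 0<m))) (half ∘ rung₂)
  go (upper₁ c<m)  = column c<m (half (lower₁ 0<m)) (half ∘ upper₁)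
  go (upper₂ sc<m) = rail sc<m (half ∘ upper₃) (half ∘ upper₂)
  go (upper₃ sc≡m) = subst (λ p → Adj p _) (sym (next-last upper sc≡m)) (half (lower₂ 1<m))
  go (lower₁ c<m)  = column c<m (half (upper₁ 0<m)) (half ∘ lower₁)
  go (lower₂ sc<m) = rail sc<m (half ∘ lower₃) (half ∘ lower₂)
  go (lower₃ sc≡m) = subst (λ p → Adj p _) (sym (next-last lower sc≡m)) (half (upper₂ 1<m))

half-bounded : ∀ {m p q} → Half m p q → proj₁ p < m × proj₁ q < m
half-bounded (rung₁ c<m)   = c<m , c<m
half-bounded (rung₂ c<m)   = c<m , c<m
half-bounded (upper₁ c<m)  = c<m , c<m
half-bounded (upper₂ sc<m) = <⇒≤ sc<m , sc<m
half-bounded (upper₃ refl) = ≤-refl , s≤s z≤n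
half-bounded (lower₁ c<m)  = c<m , c<m
half-bounded (lower₂ sc<m) = <⇒≤ sc<m , sc<m
half-bounded (lower₃ refl) = ≤-refl , s≤s z≤n

next-bounded : ∀ l v → proj₁ v < suc l → proj₁ (next (suc l) v) < suc l
next-bounded l (c , k) c<m with suc c ℕ.≟ suc l
... | yes refl rewrite next-last {suc l} {l} k refl = s≤s z≤n
... | no  neq  rewrite next-inner k (≤∧≢⇒< c<m neq) = ≤∧≢⇒< c<m neq

module _ (l : ℕ) {a b c : Vertex} (a< : proj₁ a < 2 + l) (b< : proj₁ b < 2 + l) (c< : proj₁ c < 2 + l)
         (C : Certificate (edges (2 + l) 0) (prev (suc l) a) (prev (suc l) b) (prev (suc l) c)) where
  open Certificate C

  private
    m = 2 + l
    σ = prev (suc l)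
    ρ = next m

    -- `mono` ranges over all of `ℕ × Kind`, but `σ` is injective only below column `m`: a vertex
    -- out of range could be sent into S. Out there the colour is therefore constant.
    χ′ : Vertex → Vertex → Bool
    χ′ p q = if proj₁ p <ᵇ m then χ (σ p) (σ q) else true

    χ′-inside : ∀ {p q} → proj₁ p < m → χ′ p q ≡ χ (σ p) (σ q)
    χ′-inside {p} p< rewrite Equivalence.to T-≡ (<⇒<ᵇ p<) = refl

    σ-≢ : ∀ {p v} → proj₁ p < m → p ≢ ρ (σ v) → σ p ≢ σ v
    σ-≢ {p} p< p≢ σp≡ = p≢ (trans (sym (next-prev (suc l) p p<)) (cong ρ σp≡))

    mono′ : ∀ {p} → p ≢ ρ (σ a) → p ≢ ρ (σ b) → p ≢ ρ (σ c) → ∀ q r → χ′ p q ≡ χ′ p r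
    mono′ {p} p≢a p≢b p≢c q r with proj₁ p <ᵇ m in eq
    ... | false = refl
    ... | true  = mono (σ-≢ p< p≢a) (σ-≢ p< p≢b) (σ-≢ p< p≢c) (σ q) (σ r)
      where
      p< : proj₁ p < m
      p< = <ᵇ⇒< (proj₁ p) m (Equivalence.from T-≡ eq)

    path : ∀ {i p q} → Half m p q → χ p q ≡ i → χ q p ≡ i → Star (Coloured (edges m 0) χ′ i) (ρ p) (ρ q)
    path {p = p} {q} h x y = (half-next h , trans (same p q p< q<) x , trans (same q p q< p<) y) ◅ ε
      where
      p< : proj₁ p < m
      p< = proj₁ (half-bounded h)
      q< : proj₁ q < m
      q< = proj₂ (half-bounded h)
      same : ∀ p q → proj₁ p < m → proj₁ q < m → χ′ (ρ p) (ρ q) ≡ χ p q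
      same p q p< q< = trans (χ′-inside (next-bounded (suc l) p p<))
        (cong₂ χ (prev-next (suc l) p p<) (prev-next (suc l) q q<))

  rotate : Certificate (edges m 0) a b c
  rotate = subst (λ x → Certificate (edges m 0) x b c) (next-prev (suc l) a a<)
    (subst₂ (Certificate (edges m 0) _) (next-prev (suc l) b b<) (next-prev (suc l) c c<)
      (transport ρ C χ′ mono′ (path ∘ edge⇒half)))

-- Induction on the number of rungs

unused-value : ∀ {k} (f : Fin k → ℕ) → ∃ λ i → i < suc k × (∀ j → f j ≢ i)
unused-value {k} f with any? {suc k} (λ i → all? (λ j → ¬? (f j ℕ.≟ toℕ i)))
... | yes (i , free) = toℕ i , toℕ<n i , free
-- If all `k + 1` candidates were values of `f`, chosen preimages would map `Fin (suc k)` into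
-- `Fin k`, and two candidates sharing a preimage would be equal.
... | no  none       =
  let i , j , i<j , same = pigeonhole (n<1+n k) (proj₁ ∘ taken)
      fi = proj₂ (taken i)
      fj = proj₂ (taken j)
  in contradiction (trans (sym fi) (trans (cong f same) fj)) (<⇒≢ i<j)
  where
  taken : ∀ i → ∃ λ j → f j ≡ toℕ i
  taken i = let j , ¬≢ = ¬∀⟶∃¬ k _ (λ j → ¬? (f j ℕ.≟ toℕ i)) (λ free → none (i , free))
            in j , decidable-stable (f j ℕ.≟ toℕ i) ¬≢

Ladder : ℕ → Set
Ladder m = ∀ {a b c} → proj₁ a < m → proj₁ b < m → proj₁ c < m →
  a ≢ b → a ≢ c → b ≢ c → Certificate (edges m 0) a b c

module _ (l : ℕ) (ladder : Ladder (2 + l)) where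

  private
    m = 3 + l

    prev-≢ : ∀ {a b} → proj₁ a < m → proj₁ b < m → a ≢ b → prev (2 + l) a ≢ prev (2 + l) b
    prev-≢ {a} {b} a< b< a≢b eq =
      a≢b (trans (sym (next-prev _ a a<)) (trans (cong (next m) eq) (next-prev _ b b<)))

    prev-bounded : ∀ a → proj₁ a < m → proj₁ (prev (2 + l) a) < m
    prev-bounded (zero , _)  _  = ≤-refl
    prev-bounded (suc _ , _) a< = <⇒≤ a<

    prev-free : ∀ {i} a → suc i < m → proj₁ a ≢ suc i → proj₁ (prev (2 + l) a) ≢ i
    prev-free (zero , _)  i<m _    refl = <-irrefl refl i<m
    prev-free (suc _ , _) _   a≢si refl = a≢si refl

  -- Recursion on the index of the free column: `prev` lowers it by one, and once it is 0 the
  -- vertices of S are shifts of vertices of the shorter ladder.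
  column-free : ∀ i → i < m → ∀ {a b c} → proj₁ a < m → proj₁ b < m → proj₁ c < m →
    a ≢ b → a ≢ c → b ≢ c → proj₁ a ≢ i → proj₁ b ≢ i → proj₁ c ≢ i → Certificate (edges m 0) a b c
  column-free zero _ {zero , _} _ _ _ _ _ _ a≢i _ _ = contradiction refl a≢i
  column-free zero _ {suc _ , _} {zero , _} _ _ _ _ _ _ _ b≢i _ = contradiction refl b≢i
  column-free zero _ {suc _ , _} {suc _ , _} {zero , _} _ _ _ _ _ _ _ _ c≢i = contradiction refl c≢i
  column-free zero _ {suc _ , _} {suc _ , _} {suc _ , _} (s≤s a<) (s≤s b<) (s≤s c<) a≢b a≢c b≢c _ _ _ =
    insert-column (suc l) (ladder a< b< c< (a≢b ∘ cong shift) (a≢c ∘ cong shift) (b≢c ∘ cong shift))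
  column-free (suc i) i<m {a} {b} {c} a< b< c< a≢b a≢c b≢c a≢i b≢i c≢i = rotate (suc l) a< b< c<
    (column-free i (<⇒≤ i<m) (prev-bounded a a<) (prev-bounded b b<) (prev-bounded c c<)
      (prev-≢ a< b< a≢b) (prev-≢ a< c< a≢c) (prev-≢ b< c< b≢c)
      (prev-free a i<m a≢i) (prev-free b i<m b≢i) (prev-free c i<m c≢i))

ladder : ∀ t → Ladder (3 + t)
ladder zero a< b< c< = base₃ (<⇒vertices _ a<) (<⇒vertices _ b<) (<⇒vertices _ c<)
ladder (suc t) {a} {b} {c} a< b< c< a≢b a≢c b≢c =
  -- Three vertices leave one of the columns 0 to 3 free, and all four exist because there are
  -- `4 + t` columns.
  let i , i<4 , free = unused-value {3} λ { zero → proj₁ a ; (suc zero) → proj₁ b ; (suc (suc zero)) → proj₁ c }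
  in column-free (suc t) (ladder t) i (≤-trans i<4 (s≤s (s≤s (s≤s (s≤s z≤n))))) a< b< c< a≢b a≢c b≢c
       (free zero) (free (suc zero)) (free (suc (suc zero)))

-- Suppressing vertices of degree two

module _ {W : Set} (_≟_ : DecidableEquality W) where

  -- The path s, w, t becomes the edge st. The last two conditions of `other` say that st, in either
  -- direction, is not already an edge: its ends are about to be recoloured.
  data Replaced (L′ : List (W × W)) (s w t : W) : W → W → Set where
    first  : Replaced L′ s w t s w
    second : Replaced L′ s w t w t
    other  : ∀ {p q} → (p , q) ∈ L′ → p ≢ w → q ≢ w → ¬ (p ≡ s × q ≡ t) → ¬ (p ≡ t × q ≡ s) →
             Replaced L′ s w t p q

  suppress : ∀ {L L′ : List (W × W)} {s w t a b c} → s ≢ w → t ≢ w → (s , t) ∈ L′ →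
    (∀ {p q} → (p , q) ∈ L → Replaced L′ s w t p q) →
    a ≢ w → b ≢ w → c ≢ w → Certificate L a b c → Certificate L′ a b c
  suppress {L} {L′} {s} {w} {t} {a} {b} {c} s≢w t≢w st∈L′ replaced a≢w b≢w c≢w C =
    subst (λ x → Certificate L′ x b c) (f-other a≢w)
      (subst₂ (Certificate L′ _) (f-other b≢w) (f-other c≢w) (transport f C χ′ mono′ (path ∘ replaced)))
    where
    open Certificate C

    isST? : ∀ p q → Dec ((p ≡ s × q ≡ t) ⊎ (p ≡ t × q ≡ s))
    isST? p q = ((p ≟ s) ×-dec (q ≟ t)) ⊎-dec ((p ≟ t) ×-dec (q ≟ s))

    χ′ : W → W → Bool
    χ′ p q = if does (isST? p q) then χ p w else χ p q

    χ′-st : χ′ s t ≡ χ s w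
    χ′-st rewrite dec-true (isST? s t) (inj₁ (refl , refl)) = refl

    χ′-ts : χ′ t s ≡ χ t w
    χ′-ts rewrite dec-true (isST? t s) (inj₂ (refl , refl)) = refl

    χ′-other : ∀ {p q} → ¬ (p ≡ s × q ≡ t) → ¬ (p ≡ t × q ≡ s) → χ′ p q ≡ χ p q
    χ′-other {p} {q} ¬st ¬ts rewrite dec-false (isST? p q) [ ¬st , ¬ts ]′ = refl

    -- Contract w along the edge sw if that edge is coloured, and along wt otherwise: a coloured
    -- edge at w is then contracted or, when both are coloured, carried to st.
    f : W → W
    f x = if does (x ≟ w) then (if does (χ s w Bool.≟ χ w s) then s else t) else x

    f-other : ∀ {x} → x ≢ w → f x ≡ x
    f-other {x} x≢w rewrite dec-false (x ≟ w) x≢w = refl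

    f-w : (f w ≡ s × χ s w ≡ χ w s) ⊎ (f w ≡ t × χ s w ≢ χ w s)
    f-w rewrite dec-true (w ≟ w) refl with χ s w Bool.≟ χ w s
    ... | yes eq = inj₁ (refl , eq)
    ... | no neq = inj₂ (refl , neq)

    mono′ : ∀ {p} → p ≢ f a → p ≢ f b → p ≢ f c → ∀ q r → χ′ p q ≡ χ′ p r
    mono′ {p} p≢a p≢b p≢c q r = trans (at-w q) (sym (at-w r))
      where
      at-w : ∀ q → χ′ p q ≡ χ p w
      at-w q with does (isST? p q)
      ... | true  = refl
      ... | false = mono (p≢a ∘ λ eq → trans eq (sym (f-other a≢w)))
                         (p≢b ∘ λ eq → trans eq (sym (f-other b≢w)))
                         (p≢c ∘ λ eq → trans eq (sym (f-other c≢w))) q w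

    path : ∀ {i p q} → Replaced L′ s w t p q → χ p q ≡ i → χ q p ≡ i → Star (Coloured L′ χ′ i) (f p) (f q)
    path {i} first sw ws with f-w
    ... | inj₁ (fw≡s , _)  = subst (Star _ (f s)) (trans (f-other s≢w) (sym fw≡s)) ε
    ... | inj₂ (_ , differ) = contradiction (trans sw (sym ws)) differ
    path {i} second wt tw with f-w
    ... | inj₂ (fw≡t , _)  = subst (Star _ (f w)) (trans fw≡t (sym (f-other t≢w))) ε
    -- Here both halves are coloured. Since `w` lies outside S its two ends agree, so sw has the
    -- colour `i` of wt, and st carries that colour.
    ... | inj₁ (fw≡s , agree) = subst₂ (Star _) (sym fw≡s) (sym (f-other t≢w))
      ((inj₁ st∈L′ , trans χ′-st (trans agree (trans (mono (a≢w ∘ sym) (b≢w ∘ sym) (c≢w ∘ sym) s t) wt))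
                   , trans χ′-ts tw) ◅ ε)
    path {i} (other pq∈ p≢w q≢w ¬st ¬ts) pq qp = subst₂ (Star _) (sym (f-other p≢w)) (sym (f-other q≢w))
      ((inj₁ pq∈ , trans (χ′-other ¬st ¬ts) pq , trans (χ′-other (λ (q≡s , p≡t) → ¬ts (p≡t , q≡s)) (λ (q≡t , p≡s) → ¬st (p≡s , q≡t))) qp) ◅ ε)

-- Suppressing midpoints of the ladder

mid : Vertex → Bool
mid (_ , top)    = false
mid (_ , bottom) = false
mid (_ , _)      = true

mid-end₁ : ∀ w → mid (end₁ w) ≡ false
mid-end₁ (_ , top)    = refl
mid-end₁ (_ , bottom) = refl
mid-end₁ (_ , rung)   = refl
mid-end₁ (_ , upper)  = refl
mid-end₁ (_ , lower)  = refl

mid-end₂ : ∀ m w → mid (end₂ m w) ≡ false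
mid-end₂ m (_ , top)    = refl
mid-end₂ m (_ , bottom) = refl
mid-end₂ m (_ , rung)   = refl
mid-end₂ m (c , upper)  with suc c ≡ᵇ m
... | true  = refl
... | false = refl
mid-end₂ m (c , lower)  with suc c ≡ᵇ m
... | true  = refl
... | false = refl

mids⇒mid : ∀ {m w} → w ∈ mids m → mid w ≡ true
mids⇒mid {m} {c , k} w∈ = kind (proj₂ (∈-cartesianProduct⁻ (upTo m) (rung ∷ upper ∷ lower ∷ []) w∈))
  where
  kind : k ∈ rung ∷ upper ∷ lower ∷ [] → mid (c , k) ≡ true
  kind (here refl)                 = refl
  kind (there (here refl))         = refl
  kind (there (there (here refl))) = refl

branches⇒¬mid : ∀ {m w} → w ∈ branches m → mid w ≡ false
branches⇒¬mid {m} {c , k} w∈ = kind (proj₂ (∈-cartesianProduct⁻ (upTo m) (top ∷ bottom ∷ []) w∈))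
  where
  kind : k ∈ top ∷ bottom ∷ [] → mid (c , k) ≡ false
  kind (here refl)         = refl
  kind (there (here refl)) = refl

mid-≢ : ∀ {p q} → mid p ≡ false → mid q ≡ true → p ≢ q
mid-≢ p q refl = contradiction (trans (sym p) q) λ ()

partial : ℕ → List Vertex → List Vertex → List (Vertex × Vertex)
partial m P R = map (short m) P ++ concatMap (halves m) R

-- Suppressing two midpoints with the same ends would produce a double edge. Only midpoints
-- suppressed earlier can clash in this way, because every remaining unsuppressed edge still
-- contains a midpoint.
Parallel : ℕ → Vertex → Vertex → Set
Parallel m w u = (end₁ u ≡ end₁ w × end₂ m u ≡ end₂ m w) ⊎ (end₁ u ≡ end₂ m w × end₂ m u ≡ end₁ w)

suppress-mid : ∀ {m} P w R → (∀ {u} → u ∈ w ∷ R → mid u ≡ true) → Unique (w ∷ R ++ branches m) →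
  All (¬_ ∘ Parallel m w) P →
  Certified (w ∷ R ++ branches m) (partial m P (w ∷ R)) →
  Certified (R ++ branches m) (partial m (P ++ [ w ]) R)
suppress-mid {m} P w R are-mids (w∉ ∷ _) no-parallel certified a∈ b∈ c∈ a≢b a≢c b≢c =
  suppress _≟ᵥ_ (mid-≢ (mid-end₁ w) w-mid) (mid-≢ (mid-end₂ m w) w-mid) (∈-++⁺ˡ (∈-map⁺ (short m) (∈-++⁺ʳ P (here refl))))
    replaced (avoid a∈) (avoid b∈) (avoid c∈) (certified (there a∈) (there b∈) (there c∈) a≢b a≢c b≢c)
  where
  w-mid : mid w ≡ true
  w-mid = are-mids (here refl)
  avoid : ∀ {u} → u ∈ R ++ branches m → u ≢ w
  avoid u∈ u≡w = All.lookup w∉ u∈ (sym u≡w)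
  Rep : Vertex → Vertex → Set
  Rep = Replaced _≟ᵥ_ (partial m (P ++ [ w ]) R) (end₁ w) w (end₂ m w)
  later : ∀ {p q u} → (p , q) ∈ concatMap (halves m) R → u ∈ R →
    (p , q) ≡ (end₁ u , u) ⊎ (p , q) ≡ (u , end₂ m u) → Rep p q
  later {u = u} pq∈ u∈ (inj₁ refl) = other (∈-++⁺ʳ (map (short m) (P ++ [ w ])) pq∈)
    (mid-≢ (mid-end₁ u) w-mid) (avoid (∈-++⁺ˡ u∈))
    (λ (_ , u≡) → mid-≢ (mid-end₂ m w) (are-mids (there u∈)) (sym u≡))
    (λ (_ , u≡) → mid-≢ (mid-end₁ w) (are-mids (there u∈)) (sym u≡))
  later {u = u} pq∈ u∈ (inj₂ refl) = other (∈-++⁺ʳ (map (short m) (P ++ [ w ])) pq∈)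
    (avoid (∈-++⁺ˡ u∈)) (mid-≢ (mid-end₂ m u) w-mid)
    (λ (u≡ , _) → mid-≢ (mid-end₁ w) (are-mids (there u∈)) (sym u≡))
    (λ (u≡ , _) → mid-≢ (mid-end₂ m w) (are-mids (there u∈)) (sym u≡))
  replaced : ∀ {p q} → (p , q) ∈ partial m P (w ∷ R) → Rep p q
  replaced pq∈ with ∈-++⁻ (map (short m) P) pq∈
  ... | inj₂ (here refl)         = first
  ... | inj₂ (there (here refl)) = second
  ... | inj₂ (there (there pq∈′)) = let u , u∈ , ends = ∈-halves⁻ pq∈′ in later pq∈′ u∈ ends
  ... | inj₁ pq∈′ with u , u∈ , refl ← ∈-map⁻ (short m) pq∈′ = other
    (∈-++⁺ˡ (∈-map⁺ (short m) (∈-++⁺ˡ u∈)))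
    (mid-≢ (mid-end₁ u) w-mid) (mid-≢ (mid-end₂ m u) w-mid)
    (All.lookup no-parallel u∈ ∘ inj₁) (All.lookup no-parallel u∈ ∘ inj₂)

drop-∈ : ∀ {A : Set} j {xs : List A} {x} → x ∈ drop j xs → x ∈ xs
drop-∈ zero    x∈ = x∈
drop-∈ (suc j) {_ ∷ _} x∈ = there (drop-∈ j x∈)

take-∈ : ∀ {A : Set} j {xs : List A} {x} → x ∈ take j xs → x ∈ xs
take-∈ (suc j) {_ ∷ _} (here refl) = here refl
take-∈ (suc j) {_ ∷ _} (there x∈)  = there (take-∈ j x∈)

vertices-unique : ∀ m j → Unique (vertices m j)
vertices-unique m j = Uniqueₚ.++⁺ (Uniqueₚ.drop⁺ j (Uniqueₚ.cartesianProduct⁺ (Uniqueₚ.upTo⁺ m) (((λ ()) ∷ (λ ()) ∷ []) ∷ ((λ ()) ∷ []) ∷ [] ∷ [])))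
  (Uniqueₚ.cartesianProduct⁺ (Uniqueₚ.upTo⁺ m) (((λ ()) ∷ []) ∷ [] ∷ []))
  λ (w∈mids , w∈branches) → mid-≢ (branches⇒¬mid {m} w∈branches) (mids⇒mid {m} (drop-∈ j w∈mids)) refl

end₁-branch : ∀ {m w} → w ∈ mids m → end₁ w ∈ branches m
end₁-branch {m} {c , k} w∈ = branch k
  where
  c< : c < m
  c< = mids⇒< w∈
  branch : ∀ k → end₁ (c , k) ∈ branches m
  branch top    = ∈-branches c< (here refl)
  branch bottom = ∈-branches c< (here refl)
  branch rung   = ∈-branches c< (here refl)
  branch upper  = ∈-branches c< (here refl)
  branch lower  = ∈-branches c< (there (here refl))

end₂-branch : ∀ {m w} → w ∈ mids m → end₂ m w ∈ branches m
end₂-branch {m} {c , k} w∈ = branch k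
  where
  c< : c < m
  c< = mids⇒< w∈
  on-rail : ∀ k → k ∈ top ∷ bottom ∷ [] → flip k ∈ top ∷ bottom ∷ [] → next m (c , k) ∈ branches m
  on-rail k k∈ fk∈ with suc c ℕ.≟ m
  ... | yes eq = subst (_∈ branches m) (sym (next-last k eq)) (∈-branches (≤-trans (s≤s z≤n) c<) fk∈)
  ... | no neq = subst (_∈ branches m) (sym (next-inner k (≤∧≢⇒< c< neq))) (∈-branches (≤∧≢⇒< c< neq) k∈)
  branch : ∀ k → end₂ m (c , k) ∈ branches m
  branch top    = ∈-branches c< (there (here refl))
  branch bottom = ∈-branches c< (there (here refl))
  branch rung   = ∈-branches c< (there (here refl))
  branch upper  = on-rail top (here refl) (there (here refl))
  branch lower  = on-rail bottom (there (here refl)) (here refl)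

edges⊆vertices : ∀ m j {p q} → Adjacent (edges m j) p q → p ∈ vertices m j
edges⊆vertices m j = [ proj₁ ∘ ends , proj₂ ∘ ends ]′
  where
  b : ∀ {w} → w ∈ branches m → w ∈ vertices m j
  b = ∈-++⁺ʳ (drop j (mids m))
  ends : ∀ {p q} → (p , q) ∈ edges m j → p ∈ vertices m j × q ∈ vertices m j
  ends pq∈ with ∈-++⁻ (map (short m) (take j (mids m))) pq∈
  ... | inj₁ pq∈′ with w , w∈ , refl ← ∈-map⁻ (short m) pq∈′ =
    b (end₁-branch {m} (take-∈ j w∈)) , b (end₂-branch {m} (take-∈ j w∈))
  ... | inj₂ pq∈′ with ∈-halves⁻ {ws = drop j (mids m)} pq∈′
  ...   | w , w∈ , inj₁ refl = b (end₁-branch {m} (drop-∈ j w∈)) , ∈-++⁺ˡ w∈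
  ...   | w , w∈ , inj₂ refl = ∈-++⁺ˡ w∈ , b (end₂-branch {m} (drop-∈ j w∈))

module _ (t : ℕ) where

  private
    m = 3 + t

    suppress-next : ∀ j w {R} → drop j (mids m) ≡ w ∷ R → All (¬_ ∘ Parallel m w) (take j (mids m)) →
      Certified (w ∷ R ++ branches m) (partial m (take j (mids m)) (w ∷ R)) →
      Certified (R ++ branches m) (partial m (take j (mids m) ++ [ w ]) R)
    suppress-next j w {R} eq = suppress-mid {m} (take j (mids m)) w R
      (λ u∈ → mids⇒mid {m} (drop-∈ j (subst (_ ∈_) (sym eq) u∈)))
      (subst (λ ws → Unique (ws ++ branches m)) eq (vertices-unique m j))

  certified₀ : Certified (vertices m 0) (edges m 0)
  certified₀ a∈ b∈ c∈ = ladder t (vertices⇒< a∈) (vertices⇒< b∈) (vertices⇒< c∈)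

  -- Since `m = 3 + t`, the list `mids m` unfolds far enough for `refl` to expose the next midpoint.
  -- The ones suppressed are the three of column 0 and then the rung of column 1, no two of them
  -- parallel.
  certified₁ : Certified (vertices m 1) (edges m 1)
  certified₁ = suppress-next 0 (0 , rung) refl [] certified₀

  certified₂ : Certified (vertices m 2) (edges m 2)
  certified₂ = suppress-next 1 (0 , upper) refl ((λ { (inj₁ ()) ; (inj₂ ()) }) ∷ []) certified₁

  certified₃ : Certified (vertices m 3) (edges m 3)
  certified₃ = suppress-next 2 (0 , lower) refl ((λ { (inj₁ ()) ; (inj₂ ()) }) ∷ (λ { (inj₁ ()) ; (inj₂ ()) }) ∷ []) certified₂

  certified₄ : Certified (vertices m 4) (edges m 4)
  certified₄ = suppress-next 3 (1 , rung) refl ((λ { (inj₁ ()) ; (inj₂ ()) }) ∷ (λ { (inj₁ ()) ; (inj₂ ()) }) ∷ (λ { (inj₁ ()) ; (inj₂ ()) }) ∷ []) certified₃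

-- Order and size of the ladder graphs

length-cartesianProduct : ∀ {A B : Set} (xs : List A) (ys : List B) →
  length (cartesianProduct xs ys) ≡ length xs * length ys
length-cartesianProduct []       ys = refl
length-cartesianProduct (x ∷ xs) ys = trans (length-++ (map (x ,_) ys))
  (cong₂ _+_ (length-map (x ,_) ys) (length-cartesianProduct xs ys))

length-halves : ∀ m ws → length (concatMap (halves m) ws) ≡ 2 * length ws
length-halves m []       = refl
length-halves m (w ∷ ws) = trans (cong (2 +_) (length-halves m ws)) (sym (*-suc 2 (length ws)))

length-take-drop : ∀ {A : Set} j (xs : List A) → length (take j xs) + length (drop j xs) ≡ length xs
length-take-drop j xs = trans (sym (length-++ (take j xs))) (cong length (take++drop≡id j xs))

m*n≤o⇒m≤o/n : ∀ m n o .{{_ : ℕ.NonZero n}} → m * n ≤ o → m ≤ o / n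
m*n≤o⇒m≤o/n m n o mn≤o = subst (_≤ o / n) (m*n/n≡m m n) (/-monoˡ-≤ n mn≤o)

module _ (m j : ℕ) (j≤3m : j ≤ m * 3) where

  private
    K D : ℕ
    K = length (take j (mids m))
    D = length (drop j (mids m))

    K+D : K + D ≡ m * 3
    K+D = trans (length-take-drop j (mids m)) (trans (length-cartesianProduct (upTo m) _) (cong (_* 3) (length-upTo m)))

    K≡j : K ≡ j
    K≡j = trans (length-take j (mids m))
      (m≤n⇒m⊓n≡m (subst (j ≤_) (sym (trans (sym (length-take-drop j (mids m))) K+D)) j≤3m))

    vertices-length : length (vertices m j) ≡ D + m * 2
    vertices-length = trans (length-++ (drop j (mids m)))
      (cong (D +_) (trans (length-cartesianProduct (upTo m) _) (cong (_* 2) (length-upTo m))))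

    edges-length : length (edges m j) ≡ j + 2 * D
    edges-length = trans (length-++ (map (short m) (take j (mids m))))
      (cong₂ _+_ (trans (length-map (short m) (take j (mids m))) K≡j) (length-halves m (drop j (mids m))))

    j+D : j + D ≡ m * 3
    j+D = trans (cong (_+ D) (sym K≡j)) K+D

  order : j + length (vertices m j) ≡ m * 5
  order = begin
    j + length (vertices m j)     ≡⟨ cong (j +_) vertices-length ⟩
    j + (D + m * 2)               ≡⟨ +-assoc j D (m * 2) ⟨
    j + D + m * 2                 ≡⟨ cong (_+ m * 2) j+D ⟩
    m * 3 + m * 2                 ≡⟨ *-distribˡ-+ m 3 2 ⟨
    m * 5                         ∎
    where open ≡-Reasoning

  -- Five times the size is exactly six times the order plus `j`; the 4 added in the rounding
  -- absorbs `j` precisely up to `j = 4`.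
  size : j ≤ 4 → length (edges m j) ≤ ⌈ 6 * length (vertices m j) /5⌉
  size j≤4 = m*n≤o⇒m≤o/n _ 5 _ (begin
    length (edges m j) * 5                     ≡⟨ cong (_* 5) edges-length ⟩
    (j + 2 * D) * 5                            ≡⟨ solve 2 (λ j D → (j :+ con 2 :* D) :* con 5 := con 4 :* (j :+ D) :+ con 6 :* D :+ j) refl j D ⟩
    4 * (j + D) + 6 * D + j                    ≤⟨ +-monoʳ-≤ (4 * (j + D) + 6 * D) j≤4 ⟩
    4 * (j + D) + 6 * D + 4                    ≡⟨ cong (λ x → 4 * x + 6 * D + 4) j+D ⟩
    4 * (m * 3) + 6 * D + 4                    ≡⟨ solve 2 (λ m D → con 4 :* (m :* con 3) :+ con 6 :* D :+ con 4 := con 6 :* (D :+ m :* con 2) :+ con 4) refl m D ⟩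
    6 * (D + m * 2) + 4                        ≡⟨ cong (λ x → 6 * x + 4) vertices-length ⟨
    6 * length (vertices m j) + 4              ∎)
    where open ≤-Reasoning

Extremal : ℕ → Set
Extremal n = Σ (Graph n) λ G → κ₃≡2 G × e G ≡ ⌈ 6 * n /5⌉

ladder-extremal : ∀ n t j → j ≤ 4 → j + n ≡ (3 + t) * 5 → Certified (vertices (3 + t) j) (edges (3 + t) j) → Extremal n
ladder-extremal n t j j≤4 j+n certified = subst Extremal N≡n
  (extremal _≟ᵥ_ (vertices-unique m j) (edges⊆vertices m j) certified
    (+-cancelˡ-≤ 4 4 _ (≤-trans 8≤j+N (+-monoˡ-≤ _ j≤4)))
    (size m j j≤3m j≤4))
  where
  m = 3 + t
  N = length (vertices m j)
  j≤3m : j ≤ m * 3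
  j≤3m = ≤-trans j≤4 (m≤m+n 4 _)
  N≡n : N ≡ n
  N≡n = +-cancelˡ-≡ j N n (trans (order m j j≤3m) (sym j+n))
  8≤j+N : 8 ≤ j + N
  8≤j+N = subst (8 ≤_) (sym (order m j j≤3m)) (m≤m+n 8 _)

-- Writing `k = r + 5t` with `r ≤ 4` gives `11 + k = 5(3 + t) - (4 - r)`, so `4 - r` midpoints are
-- suppressed in the ladder with `3 + t` rungs.
large-extremal : ∀ k → Extremal (11 + k)
large-extremal k with k divMod 5
... | result t zero refl = ladder-extremal _ t 4 ≤-refl refl (certified₄ t)
... | result t (suc zero) refl = ladder-extremal _ t 3 (m≤m+n 3 1) refl (certified₃ t)
... | result t (suc (suc zero)) refl = ladder-extremal _ t 2 (m≤m+n 2 2) refl (certified₂ t)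
... | result t (suc (suc (suc zero))) refl = ladder-extremal _ t 1 (m≤m+n 1 3) refl (certified₁ t)
... | result t (suc (suc (suc (suc zero)))) refl = ladder-extremal _ t 0 z≤n refl (certified₀ t)

-- Orders 4 to 8, and the theorem

≡ᵇ-sound : ∀ {p q} → T (p ≡ᵇ q) → p ≡ q
≡ᵇ-sound {p} {q} = ≡ᵇ⇒≡ p q

module _ (n : ℕ) (L : List (ℕ × ℕ)) (Ms : List (List ℕ)) where

  small-extremal : allTriples (Check.check _≡ᵇ_ ≡ᵇ-sound L Ms) (upTo n) ≡ true → {True (All.all? (λ (p , q) → (p <? n) ×-dec (q <? n)) L)} →
    4 ≤ n → length L ≤ ⌈ 6 * n /5⌉ → Extremal n
  small-extremal checked {bounded} 4≤n L≤ = subst Extremal (length-upTo n)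
    (extremal ℕ._≟_ (Uniqueₚ.upTo⁺ n) [ ∈-upTo⁺ ∘ proj₁ ∘ ends , ∈-upTo⁺ ∘ proj₂ ∘ ends ]′ (Check.certified _≡ᵇ_ ≡ᵇ-sound L Ms (upTo n) checked)
      (subst (4 ≤_) (sym (length-upTo n)) 4≤n) (subst (λ N → length L ≤ ⌈ 6 * N /5⌉) (sym (length-upTo n)) L≤))
    where
    ends : ∀ {p q} → (p , q) ∈ L → p < n × q < n
    ends = All.lookup (toWitness bounded)

-- K₄ minus an edge, K₂,₃, and K₄ with two, three or four edges of a 4-cycle subdivided.
extremal-4 : Extremal 4
extremal-4 = small-extremal 4
  ((0 , 1) ∷ (0 , 2) ∷ (2 , 1) ∷ (0 , 3) ∷ (3 , 1) ∷ [])
  ((0 ∷ 2 ∷ 3 ∷ []) ∷ [])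
  refl (m≤m+n 4 _) ≤-refl

extremal-5 : Extremal 5
extremal-5 = small-extremal 5
  ((0 , 2) ∷ (2 , 1) ∷ (0 , 3) ∷ (3 , 1) ∷ (0 , 4) ∷ (4 , 1) ∷ [])
  ((0 ∷ 2 ∷ 3 ∷ []) ∷ (1 ∷ 2 ∷ 3 ∷ []) ∷ (0 ∷ 2 ∷ 4 ∷ []) ∷ [])
  refl (m≤m+n 4 _) ≤-refl

extremal-6 : Extremal 6
extremal-6 = small-extremal 6
  ((0 , 4) ∷ (4 , 1) ∷ (2 , 5) ∷ (5 , 3) ∷ (0 , 2) ∷ (1 , 3) ∷ (0 , 3) ∷ (1 , 2) ∷ [])
  ((0 ∷ 2 ∷ 4 ∷ 5 ∷ []) ∷ (0 ∷ 1 ∷ 2 ∷ []) ∷ [])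
  refl (m≤m+n 4 _) ≤-refl

extremal-7 : Extremal 7
extremal-7 = small-extremal 7
  ((0 , 4) ∷ (4 , 1) ∷ (2 , 5) ∷ (5 , 3) ∷ (0 , 6) ∷ (6 , 2) ∷ (1 , 3) ∷ (0 , 3) ∷ (1 , 2) ∷ [])
  ((1 ∷ 2 ∷ 4 ∷ 5 ∷ []) ∷ (0 ∷ 3 ∷ 4 ∷ 5 ∷ []) ∷ (0 ∷ 1 ∷ 2 ∷ 3 ∷ []) ∷ (0 ∷ 1 ∷ 4 ∷ 6 ∷ []) ∷ [])
  refl (m≤m+n 4 _) ≤-refl

extremal-8 : Extremal 8
extremal-8 = small-extremal 8
  ((0 , 4) ∷ (4 , 1) ∷ (2 , 5) ∷ (5 , 3) ∷ (0 , 6) ∷ (6 , 2) ∷ (1 , 7) ∷ (7 , 3) ∷ (0 , 3) ∷ (1 , 2) ∷ [])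
  ((1 ∷ 2 ∷ 4 ∷ 5 ∷ []) ∷ (0 ∷ 3 ∷ 4 ∷ 5 ∷ []) ∷ (0 ∷ 1 ∷ 2 ∷ 3 ∷ 4 ∷ []) ∷ (0 ∷ 1 ∷ 2 ∷ 3 ∷ 5 ∷ []) ∷ (1 ∷ 2 ∷ 4 ∷ 6 ∷ []) ∷ (1 ∷ 2 ∷ 5 ∷ 7 ∷ []) ∷ [])
  refl (m≤m+n 4 _) ≤-refl

theorem1 : ((n : ℕ) → 1 ≤ n → (G : Graph n) → κ₃≡2 G → ⌈ 6 * n /5⌉ ≤ e G)
    × ((n : ℕ) → 4 ≤ n → n ≢ 9 → n ≢ 10 →
    Σ (Graph n) λ G → κ₃≡2 G × (e G ≡ ⌈ 6 * n /5⌉))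
theorem1 = (λ n _ G κ → size-bound G κ) , sharp
  where
  sharp : ∀ n → 4 ≤ n → n ≢ 9 → n ≢ 10 → Extremal n
  sharp 0 () _ _
  sharp 1 (s≤s ()) _ _
  sharp 2 (s≤s (s≤s ())) _ _
  sharp 3 (s≤s (s≤s (s≤s ()))) _ _
  sharp 4 _ _ _ = extremal-4
  sharp 5 _ _ _ = extremal-5
  sharp 6 _ _ _ = extremal-6
  sharp 7 _ _ _ = extremal-7
  sharp 8 _ _ _ = extremal-8
  sharp 9 _ n≢9 _ = contradiction refl n≢9
  sharp 10 _ _ n≢10 = contradiction refl n≢10
  sharp (suc (suc (suc (suc (suc (suc (suc (suc (suc (suc (suc k))))))))))) _ _ _ = large-extremal k
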